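{- $$\sum_{n\ge0}T(n)q^n=\sum_{n\ge0}\frac{q^{2n(n+1)}(q;q^2)_n(-q^{2n+2};q)_\infty}{(q^2;q^2)_n},$$ where $T(n)$ is the number of partitions $\lambda$ of $n$ such that: $m_j(\lambda)\le 1$ for odd $j$; $m_j(\lambda)=0$ for odd $j<R_1(\lambda)+2$; $m_j(\lambda)\ge2$ for even $j$ with $0<j<R_1(\lambda)$; and no two consecutive integers both appear as parts of $\lambda$.
   Context: $m_j(\lambda)$ is the multiplicity of $j$ in $\lambda$; $R_1(\lambda)$ is the largest part of multiplicity at least $2$, or $0$ if none. $(x;q)_n=\prod_{h=0}^{n-1}(1-xq^h)$, $(x;q)_0=1$, $(x;q)_\infty=\prod_{h\ge0}(1-xq^h)$; $T(0)=1$ (empty partition). -}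

module Defs where

open import Data.Fin.Base using (toℕ)
open import Data.Integer.Base as ℤ using (ℤ; 0ℤ; 1ℤ)
import Data.Integer.Properties as ℤₚ
open import Data.List.Base using (List; []; _∷_; [_]; length; map; filter; concatMap; upTo)
open import Data.List.Extrema.Nat using (max)
open import Data.List.Membership.Propositional using (_∈_; _∉_; find; lose)
open import Data.List.Membership.Propositional.Properties
  using (∈-concatMap⁺; ∈-concatMap⁻; ∈-map⁺; ∈-map⁻; ∈-upTo⁺; ∈-upTo⁻)
open import Data.List.Properties using (filter-none; ∷-injectiveˡ; ∷-injectiveʳ)
open import Data.List.Relation.Binary.Disjoint.Propositional using (Disjoint)
open import Data.List.Relation.Unary.All as All using (All; []; _∷_)
import Data.List.Relation.Unary.All.Properties as Allₚ
open import Data.List.Relation.Unary.AllPairs as AllPairs using ([]; _∷_)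
import Data.List.Relation.Unary.AllPairs.Properties as AllPairsₚ
open import Data.List.Relation.Unary.Any using (here)
open import Data.List.Relation.Unary.Linked as Linked using (Linked; []; [-]; _∷_)
open import Data.List.Relation.Unary.Unique.Propositional using (Unique)
import Data.List.Relation.Unary.Unique.Propositional.Properties as Uniqueₚ
open import Data.Nat.Base using (ℕ; zero; suc; _+_; _*_; _∸_; _⊓_; _≤_; _<_; _≥_; z≤n; s≤s)
open import Data.Nat.Divisibility using (_∣_; _∤_; _∣?_)
open import Data.Nat.ListAction renaming (sum to sumᴸ)
open import Data.Nat.Properties as ℕₚ using (_≟_; _≤?_; _<?_)
open import Data.Product.Base using (∃; _×_; _,_; proj₁)
open import Function.Base using (_∘_)
open import Function.Bundles using (_⇔_; mk⇔)
open import Relation.Binary.PropositionalEquality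
  using (_≡_; _≢_; _≗_; refl; sym; trans; cong; subst; module ≡-Reasoning)
open import Relation.Nullary using (¬_; Dec; yes; no)
open import Relation.Nullary.Decidable using (map′; _×-dec_; _→-dec_; ¬?)

open import Data.List.Membership.DecPropositional _≟_ using (_∈?_)
open import Algebra.Properties.Semiring.Sum ℤₚ.+-*-semiring public
  using (sum; sum-syntax; sum⁺-syntax)

PowerSeries : Set
PowerSeries = ℕ → ℤ

infixr 8 _^ₛ_
infixl 7 _*ₛ_ _/ₛ_
infix  8 -ₛ_
infixl 6 _-ₛ_

1ₛ : PowerSeries
1ₛ zero    = 1ℤ
1ₛ (suc _) = 0ℤ

q : PowerSeries
q zero    = 0ℤ
q (suc k) = 1ₛ k

-ₛ_ : PowerSeries → PowerSeries
(-ₛ f) k = ℤ.- f k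

_-ₛ_ : PowerSeries → PowerSeries → PowerSeries
(f -ₛ g) k = f k ℤ.- g k

_*ₛ_ : PowerSeries → PowerSeries → PowerSeries
(f *ₛ g) k = ∑[ i ≤ k ] (f (toℕ i) ℤ.* g (k ∸ toℕ i))

_^ₛ_ : PowerSeries → ℕ → PowerSeries
f ^ₛ zero  = 1ₛ
f ^ₛ suc n = f *ₛ f ^ₛ n

-- Long division.  It is the quotient only when g has constant term 1;
-- see /ₛ-*ₛ.
_/ₛ_ : PowerSeries → PowerSeries → PowerSeries
(f /ₛ g) zero    = f 0
(f /ₛ g) (suc k) = ((λ i → f (suc i) ℤ.- f 0 ℤ.* g (suc i)) /ₛ g) k

/ₛ-*ₛ : ∀ f g → g 0 ≡ 1ℤ → (f /ₛ g) *ₛ g ≗ f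
/ₛ-*ₛ f g g₀ zero = begin
  f 0 ℤ.* g 0 ℤ.+ 0ℤ  ≡⟨ ℤₚ.+-identityʳ _ ⟩
  f 0 ℤ.* g 0         ≡⟨ cong (f 0 ℤ.*_) g₀ ⟩
  f 0 ℤ.* 1ℤ          ≡⟨ ℤₚ.*-identityʳ _ ⟩
  f 0                 ∎
  where open ≡-Reasoning
/ₛ-*ₛ f g g₀ (suc k) = begin
  f 0 ℤ.* g (suc k) ℤ.+ ((f′ /ₛ g) *ₛ g) k
    ≡⟨ cong (ℤ._+_ (f 0 ℤ.* g (suc k))) (/ₛ-*ₛ f′ g g₀ k) ⟩
  f 0 ℤ.* g (suc k) ℤ.+ (f (suc k) ℤ.- f 0 ℤ.* g (suc k))
    ≡⟨ ℤₚ.+-comm (f 0 ℤ.* g (suc k)) _ ⟩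
  f (suc k) ℤ.- f 0 ℤ.* g (suc k) ℤ.+ f 0 ℤ.* g (suc k)
    ≡⟨ ℤₚ.+-assoc (f (suc k)) _ _ ⟩
  f (suc k) ℤ.+ (ℤ.- (f 0 ℤ.* g (suc k)) ℤ.+ f 0 ℤ.* g (suc k))
    ≡⟨ cong (ℤ._+_ (f (suc k))) (ℤₚ.+-inverseˡ (f 0 ℤ.* g (suc k))) ⟩
  f (suc k) ℤ.+ 0ℤ
    ≡⟨ ℤₚ.+-identityʳ _ ⟩
  f (suc k) ∎
  where
  open ≡-Reasoning
  f′ : PowerSeries
  f′ i = f (suc i) ℤ.- f 0 ℤ.* g (suc i)

infix 4 _⟶_ _SumsTo_

_⟶_ : (ℕ → PowerSeries) → PowerSeries → Set
s ⟶ f = ∀ k → ∃ λ N → ∀ n → N ≤ n → s n k ≡ f k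

_SumsTo_ : (ℕ → PowerSeries) → PowerSeries → Set
t SumsTo f = (λ N k → ∑[ n < N ] (t (toℕ n) k)) ⟶ f

-- (x;p)_n, with base p
⟨_⨾_⟩_ : PowerSeries → PowerSeries → ℕ → PowerSeries
⟨ x ⨾ p ⟩ zero  = 1ₛ
⟨ x ⨾ p ⟩ suc n = ⟨ x ⨾ p ⟩ n *ₛ (1ₛ -ₛ x *ₛ p ^ₛ n)

-- When p has zero constant term, p^h has order at least h, so the first
-- k + 1 factors already determine the k-th coefficient of the product;
-- see ⟨⨾⟩⟶⟨⨾⟩∞.
⟨_⨾_⟩∞ : PowerSeries → PowerSeries → PowerSeries
⟨ x ⨾ p ⟩∞ k = (⟨ x ⨾ p ⟩ suc k) k

*ₛ-order : ∀ f g n → (∀ i → i < n → g i ≡ 0ℤ) → ∀ i → i < n → (f *ₛ g) i ≡ 0ℤ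
*ₛ-order f g n g≡0 zero i<n
  rewrite g≡0 0 i<n | ℤₚ.*-zeroʳ (f 0) = refl
*ₛ-order f g n g≡0 (suc i) i<n
  rewrite g≡0 (suc i) i<n | ℤₚ.*-zeroʳ (f 0)
        | *ₛ-order (f ∘ suc) g n g≡0 i (ℕₚ.<-trans (ℕₚ.n<1+n i) i<n) = refl

^ₛ-order : ∀ p → p 0 ≡ 0ℤ → ∀ n i → i < n → (p ^ₛ n) i ≡ 0ℤ
^ₛ-order p p₀ (suc n) zero    _ rewrite p₀ = refl
^ₛ-order p p₀ (suc n) (suc i) (s≤s i<n) rewrite p₀ =
  trans (ℤₚ.+-identityˡ _) (*ₛ-order (p ∘ suc) (p ^ₛ n) n (^ₛ-order p p₀ n) i i<n)

*ₛ-≈1 : ∀ f g k → g 0 ≡ 1ℤ → (∀ i → i < k → g (suc i) ≡ 0ℤ) → (f *ₛ g) k ≡ f k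
*ₛ-≈1 f g zero g₀ _ rewrite g₀ = trans (ℤₚ.+-identityʳ _) (ℤₚ.*-identityʳ _)
*ₛ-≈1 f g (suc k) g₀ g≡0 rewrite g≡0 k (ℕₚ.n<1+n k) | ℤₚ.*-zeroʳ (f 0) =
  trans (ℤₚ.+-identityˡ _)
    (*ₛ-≈1 (f ∘ suc) g k g₀ (λ i i<k → g≡0 i (ℕₚ.m<n⇒m<1+n i<k)))

⟨⨾⟩-stable : ∀ x p → p 0 ≡ 0ℤ → ∀ k n → k < n → (⟨ x ⨾ p ⟩ suc n) k ≡ (⟨ x ⨾ p ⟩ n) k
⟨⨾⟩-stable x p p₀ k n k<n = *ₛ-≈1 (⟨ x ⨾ p ⟩ n) (1ₛ -ₛ x *ₛ p ^ₛ n) k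
  (cong (ℤ._-_ 1ℤ) (u≡0 0 (ℕₚ.≤-<-trans z≤n k<n)))
  (λ i i<k → cong (ℤ._-_ 0ℤ) (u≡0 (suc i) (ℕₚ.≤-<-trans i<k k<n)))
  where
  u≡0 : ∀ i → i < n → (x *ₛ p ^ₛ n) i ≡ 0ℤ
  u≡0 = *ₛ-order x (p ^ₛ n) n (^ₛ-order p p₀ n)

⟨⨾⟩⟶⟨⨾⟩∞ : ∀ x p → p 0 ≡ 0ℤ → ⟨ x ⨾ p ⟩_ ⟶ ⟨ x ⨾ p ⟩∞
⟨⨾⟩⟶⟨⨾⟩∞ x p p₀ k = suc k , λ n k<n →
  subst (λ m → (⟨ x ⨾ p ⟩ m) k ≡ (⟨ x ⨾ p ⟩∞) k) (ℕₚ.m∸n+n≡m k<n) (go (n ∸ suc k))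
  where
  go : ∀ d → (⟨ x ⨾ p ⟩ (d + suc k)) k ≡ (⟨ x ⨾ p ⟩∞) k
  go zero    = refl
  go (suc d) = trans (⟨⨾⟩-stable x p p₀ k (d + suc k) (ℕₚ.m≤n+m (suc k) d)) (go d)

⟨⨾⟩-constant : ∀ x p n → x 0 ≡ 0ℤ → (⟨ x ⨾ p ⟩ n) 0 ≡ 1ℤ
⟨⨾⟩-constant x p zero    x₀ = refl
⟨⨾⟩-constant x p (suc n) x₀ rewrite ⟨⨾⟩-constant x p n x₀ | x₀ = refl

record IsPartition (n : ℕ) (xs : List ℕ) : Set where
  constructor mkPartition
  field
    decreasing : Linked _≥_ xs
    positive   : All (0 <_) xs
    total      : sumᴸ xs ≡ n

-- boundedPartitions l k n lists the partitions of n into at most l parts,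
-- all of them at most k.
boundedPartitions : ℕ → ℕ → ℕ → List (List ℕ)
boundedPartitions _       _ zero    = [ [] ]
boundedPartitions zero    _ (suc _) = []
boundedPartitions (suc l) k (suc n) =
  concatMap (λ j → map (suc j ∷_) (boundedPartitions l (suc j) (n ∸ j))) (upTo (k ⊓ suc n))

partitions : ℕ → List (List ℕ)
partitions n = boundedPartitions n n n

private
  part : ℕ → ℕ → ℕ → List (List ℕ)
  part l n j = map (suc j ∷_) (boundedPartitions l (suc j) (n ∸ j))

  bounded⁻ : ∀ l k n {xs} → xs ∈ boundedPartitions l k n →
             IsPartition n xs × Linked _≥_ (k ∷ xs)
  bounded⁻ l k zero (here refl) = mkPartition [] [] refl , [-]
  bounded⁻ (suc l) k (suc n) xs∈
    with find (∈-concatMap⁻ (part l n) {upTo (k ⊓ suc n)} xs∈)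
  ... | j , j∈ , xs∈j with ∈-map⁻ (suc j ∷_) xs∈j
  ... | ys , ys∈ , refl with bounded⁻ l (suc j) (n ∸ j) ys∈ | ∈-upTo⁻ j∈
  ... | mkPartition _ pos tot , dec | j<m =
    mkPartition dec (s≤s z≤n ∷ pos) (cong suc (trans (cong (j +_) tot) (ℕₚ.m+[n∸m]≡n j≤n))) ,
    ℕₚ.m<n⊓o⇒m<n k (suc n) j<m ∷ dec
    where
    j≤n : j ≤ n
    j≤n = ℕₚ.≤-pred (ℕₚ.m<n⊓o⇒m<o k (suc n) j<m)

  bounded⁺ : ∀ l k n {xs} → IsPartition n xs → Linked _≥_ (k ∷ xs) → length xs ≤ l →
             xs ∈ boundedPartitions l k n
  bounded⁺ l k n {[]} (mkPartition _ _ refl) _ _ = here refl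
  bounded⁺ (suc l) k n {suc j ∷ xs} (mkPartition dec (_ ∷ pos) refl) (j<k ∷ _) (s≤s len) =
    ∈-concatMap⁺ (part l _) (lose (∈-upTo⁺ (ℕₚ.⊓-glb j<k (s≤s (ℕₚ.m≤m+n j _))))
      (∈-map⁺ (suc j ∷_) (bounded⁺ l (suc j) _
        (mkPartition (Linked.tail dec) pos (sym (ℕₚ.m+n∸m≡n j (sumᴸ xs)))) dec len)))

  bounded-! : ∀ l k n → Unique (boundedPartitions l k n)
  bounded-! _       _ zero    = [] ∷ []
  bounded-! zero    _ (suc _) = []
  bounded-! (suc l) k (suc n) = Uniqueₚ.concat⁺
    (Allₚ.map⁺ (All.universal
      (λ j → Uniqueₚ.map⁺ ∷-injectiveʳ (bounded-! l (suc j) (n ∸ j))) (upTo (k ⊓ suc n))))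
    (AllPairsₚ.map⁺ (AllPairs.map disjoint (Uniqueₚ.upTo⁺ (k ⊓ suc n))))
    where
    disjoint : ∀ {i j} → i ≢ j → Disjoint (part l n i) (part l n j)
    disjoint i≢j (v∈i , v∈j) with ∈-map⁻ _ v∈i | ∈-map⁻ _ v∈j
    ... | _ , _ , refl | _ , _ , eq = i≢j (ℕₚ.suc-injective (∷-injectiveˡ eq))

  length≤sum : ∀ {xs} → All (0 <_) xs → length xs ≤ sumᴸ xs
  length≤sum []         = z≤n
  length≤sum (px ∷ pxs) = ℕₚ.+-mono-≤ px (length≤sum pxs)

  ∷-sum : ∀ {xs} → Linked _≥_ xs → Linked _≥_ (sumᴸ xs ∷ xs)
  ∷-sum {[]}     _   = [-]
  ∷-sum {x ∷ xs} dec = ℕₚ.m≤m+n x (sumᴸ xs) ∷ dec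

∈-partitions : ∀ n xs → xs ∈ partitions n ⇔ IsPartition n xs
∈-partitions n xs = mk⇔ (proj₁ ∘ bounded⁻ n n n) complete
  where
  complete : IsPartition n xs → xs ∈ partitions n
  complete p@(mkPartition dec pos refl) = bounded⁺ n n n p (∷-sum dec) (length≤sum pos)

partitions-! : ∀ n → Unique (partitions n)
partitions-! n = bounded-! n n n

mult : ℕ → List ℕ → ℕ
mult j xs = length (filter (j ≟_) xs)

R₁ : List ℕ → ℕ
R₁ xs = max 0 (filter (λ j → 2 ≤? mult j xs) xs)

record Admissible (xs : List ℕ) : Set where
  constructor mkAdmissible
  field
    odd-mult       : ∀ j → 2 ∤ j → mult j xs ≤ 1
    odd-absent     : ∀ j → 2 ∤ j → j < R₁ xs + 2 → mult j xs ≡ 0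
    even-repeated  : ∀ j → 2 ∣ j → 0 < j → j < R₁ xs → 2 ≤ mult j xs
    no-consecutive : ∀ j → ¬ (j ∈ xs × suc j ∈ xs)

private
  mult-∉ : ∀ {j xs} → j ∉ xs → mult j xs ≡ 0
  mult-∉ {j} {xs} j∉xs = cong length
    (filter-none (j ≟_) (All.tabulate (λ x∈xs j≡x → j∉xs (subst (_∈ xs) (sym j≡x) x∈xs))))

  odd-mult? : ∀ xs → Dec (∀ j → 2 ∤ j → mult j xs ≤ 1)
  odd-mult? xs = map′ to (λ h → All.tabulate (λ {j} _ → h j))
    (All.all? (λ j → ¬? (2 ∣? j) →-dec (mult j xs ≤? 1)) xs)
    where
    to : All (λ j → 2 ∤ j → mult j xs ≤ 1) xs → ∀ j → 2 ∤ j → mult j xs ≤ 1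
    to h j odd with j ∈? xs
    ... | yes j∈xs = All.lookup h j∈xs odd
    ... | no  j∉xs = ℕₚ.≤-trans (ℕₚ.≤-reflexive (mult-∉ j∉xs)) z≤n

  odd-absent? : ∀ xs → Dec (∀ j → 2 ∤ j → j < R₁ xs + 2 → mult j xs ≡ 0)
  odd-absent? xs = map′ (λ h j odd j<R → h j<R odd) (λ h {j} j<R odd → h j odd j<R)
    (ℕₚ.allUpTo? (λ j → ¬? (2 ∣? j) →-dec (mult j xs ≟ 0)) (R₁ xs + 2))

  even-repeated? : ∀ xs → Dec (∀ j → 2 ∣ j → 0 < j → j < R₁ xs → 2 ≤ mult j xs)
  even-repeated? xs =
    map′ (λ h j even 0<j j<R → h j<R even 0<j) (λ h {j} j<R even 0<j → h j even 0<j j<R)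
      (ℕₚ.allUpTo? (λ j → (2 ∣? j) →-dec ((0 <? j) →-dec (2 ≤? mult j xs))) (R₁ xs))

  no-consecutive? : ∀ xs → Dec (∀ j → ¬ (j ∈ xs × suc j ∈ xs))
  no-consecutive? xs =
    map′ (λ h j (j∈xs , sj∈xs) → All.lookup h j∈xs sj∈xs)
         (λ h → All.tabulate (λ {j} j∈xs sj∈xs → h j (j∈xs , sj∈xs)))
      (All.all? (λ j → ¬? (suc j ∈? xs)) xs)

admissible? : ∀ xs → Dec (Admissible xs)
admissible? xs =
  map′ (λ (a , b , c , d) → mkAdmissible a b c d)
       (λ (mkAdmissible a b c d) → a , b , c , d)
    (odd-mult? xs ×-dec odd-absent? xs ×-dec even-repeated? xs ×-dec no-consecutive? xs)

T : ℕ → ℕ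
T n = length (filter admissible? (partitions n))

{-# OPTIONS --safe #-}
module Submission where

-- An admissible partition with R₁ = 2r consists of the parts 2, 4, …, 2r, each
-- at least twice, and of parts > 2r + 1 that differ pairwise by at least 2.
-- If A_m is the generating function of the partitions into parts > m that
-- differ by at least 2, then Σ T(n) qⁿ = Σ x_n(1) A_{1+2n}, where
-- x_n(m) = q^{2n(n+m)} / (q²;q²)_n.  The right-hand side of the theorem is
-- Σ x_n(1) (q;q²)_n P_{1+2n}, where P_m = (-q^{m+1};q)_∞.  Both b_n(m) = A_{m+2n}
-- and b_n(m) = (q;q²)_n P_{m+2n} satisfy, with v = q^{m+1} and y = q^{2n},
--   b_n(m) + v² y b_{n+1}(m) = b_n(m+1) + (v + v²) y b_n(m+2).
-- Multiplied by y x_n(m), this telescopes: S(m) = Σ x_n(m) b_n(m) satisfies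
--   S(m) = S(m+1) + (v + v²) S(m+2).
-- Since S(m) = 1 + O(q^{m+1}), this recurrence determines S.

open import Defs
open import Algebra.Bundles using (CommutativeRing; CommutativeSemiring)
import Algebra.Solver.Ring.NaturalCoefficients.Default as Solver
open import Data.Fin.Base using (toℕ)
open import Data.Integer.Base as ℤ using (ℤ; +_; 0ℤ)
import Data.Integer.Properties as ℤₚ
open import Data.List.Base using (List; []; _∷_; _++_; length; map; filter; concatMap; applyUpTo; upTo)
open import Data.List.Extrema.Nat using (max≤v⁺; v≤max⁺; argmax-sel)
open import Data.List.Membership.Propositional using (_∈_; _∉_; find; lose)
open import Data.List.Membership.Propositional.Properties
  using (∈-map⁺; ∈-map⁻; ∈-++⁺ˡ; ∈-++⁺ʳ; ∈-++⁻; ∈-filter⁺; ∈-filter⁻; ∈-concatMap⁺; ∈-concatMap⁻; ∈-upTo⁺)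
open import Data.List.Properties
  using (∷-injectiveʳ; filter-accept; filter-reject; filter-none; length-++; length-map)
open import Data.List.Relation.Unary.All as All using (All; []; _∷_)
import Data.List.Relation.Unary.All.Properties as Allₚ
open import Data.List.Relation.Unary.AllPairs as AllPairs using (AllPairs; []; _∷_)
import Data.List.Relation.Unary.AllPairs.Properties as AllPairsₚ
open import Data.List.Relation.Unary.Any using (here; there)
import Data.List.Relation.Unary.Linked.Properties as Linkedₚ
open import Data.List.Relation.Unary.Unique.Propositional using (Unique)
import Data.List.Relation.Unary.Unique.Propositional.Properties as Uniqueₚ
open import Data.Nat.Base using (ℕ; zero; suc; _+_; _*_; _∸_; _≤_; _<_; _≥_; z≤n; s≤s)
open import Data.Nat.Divisibility using (_∣_; _∤_; _∣?_; divides; m∣m*n; ∣m+n∣m⇒∣n; ∣1⇒≡1)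
open import Data.Nat.ListAction renaming (sum to sumᴸ)
import Data.Nat.Properties as ℕₚ
open import Data.List.Membership.DecPropositional ℕₚ._≟_ using (_∈?_)
import Data.Nat.Tactic.RingSolver as ℕ-Solver
open import Data.Product.Base using (∃; _×_; _,_; proj₁; proj₂)
open import Data.Sum.Base using (_⊎_; inj₁; inj₂; [_,_]′)
open import Function.Base using (_∘_; id)
open import Level using (0ℓ)
open import Relation.Binary.PropositionalEquality
  using (_≡_; _≢_; _≗_; refl; sym; trans; cong; cong₂; subst; module ≡-Reasoning)
import Relation.Binary.Reasoning.Setoid as SetoidReasoning
open import Relation.Nullary using (¬_; yes; no; contradiction)
open import Algebra.Properties.Semiring.Sum ℤₚ.+-*-semiring using (sum-cong-≗)
open import Data.List.Membership.Propositional.Properties.WithK using (unique∧set⇒bag)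
open import Data.List.Relation.Binary.BagAndSetEquality using (∼bag⇒↭)
open import Data.List.Relation.Binary.Disjoint.Propositional using (Disjoint)
open import Data.List.Relation.Binary.Permutation.Propositional.Properties using (↭-length)
open import Function.Bundles using (_⇔_; mk⇔; Equivalence)

-- Only m = 1 is wanted, but the recurrence links three values of m, so the identity is proved for
-- all m at once. The shape of an admissible partition comes from its top repeated part 2r: parts
-- above it occur once and are never consecutive, hence differ by at least 2; 2r + 1 is odd and
-- below R₁ + 2, hence absent; and 2r + 2 is already far enough from 2r, so the two halves are
-- independent. Infinite sums never occur. A coefficient of degree k is compared in partial sums
-- with N > k terms, where it no longer changes, and the lists of partitions need only be complete
-- up to size k. Factors 1 - w are kept free of subtraction, as e′ + e w = e for e′ = e (1 - w), so
-- that the algebra takes place in a commutative semiring.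

module IntSolver = Solver ℤₚ.+-*-commutativeSemiring

-- The ring of formal power series

infixl 6 _+ₛ_

_+ₛ_ : PowerSeries → PowerSeries → PowerSeries
(f +ₛ g) k = f k ℤ.+ g k

0ₛ : PowerSeries
0ₛ _ = 0ℤ

-- A record, so that the two series can be inferred from an equality.
infix 4 _≋_
record _≋_ (f g : PowerSeries) : Set where
  constructor coefficientwise
  field
    at : f ≗ g
open _≋_ public

-- By computation the product splits off `f 0`; commutativity needs the mirror image, which splits
-- off `g 0`.
*ₛ-unfoldʳ : ∀ f g k → (f *ₛ g) (suc k) ≡ f (suc k) ℤ.* g 0 ℤ.+ (f *ₛ (g ∘ suc)) k
*ₛ-unfoldʳ f g zero = IntSolver.solve 4
  (λ a b c d → a :* b :+ (c :* d :+ con 0) := c :* d :+ (a :* b :+ con 0)) refl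
  (f 0) (g 1) (f 1) (g 0)
  where open IntSolver
*ₛ-unfoldʳ f g (suc k) = trans
  (cong (ℤ._+_ (f 0 ℤ.* g (suc (suc k)))) (*ₛ-unfoldʳ (f ∘ suc) g k))
  (x+yz (f 0 ℤ.* g (suc (suc k))) (f (suc (suc k)) ℤ.* g 0) _)
  where
  x+yz : ∀ x y z → x ℤ.+ (y ℤ.+ z) ≡ y ℤ.+ (x ℤ.+ z)
  x+yz = IntSolver.solve 3 (λ x y z → x :+ (y :+ z) := y :+ (x :+ z)) refl
    where open IntSolver

*ₛ-comm : ∀ f g → f *ₛ g ≗ g *ₛ f
*ₛ-comm f g zero    = cong (ℤ._+ 0ℤ) (ℤₚ.*-comm (f 0) (g 0))
*ₛ-comm f g (suc k) = trans
  (cong₂ ℤ._+_ (ℤₚ.*-comm (f 0) (g (suc k))) (*ₛ-comm (f ∘ suc) g k))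
  (sym (*ₛ-unfoldʳ g f k))

infix 4 _≈[_]_
_≈[_]_ : PowerSeries → ℕ → PowerSeries → Set
f ≈[ k ] g = ∀ j → j ≤ k → f j ≡ g j

*ₛ-congˡ≤ : ∀ f {g h} k → g ≈[ k ] h → f *ₛ g ≈[ k ] f *ₛ h
*ₛ-congˡ≤ f k g≈h zero    j≤k = cong (λ z → f 0 ℤ.* z ℤ.+ 0ℤ) (g≈h 0 j≤k)
*ₛ-congˡ≤ f k g≈h (suc j) j≤k = cong₂ (λ x y → f 0 ℤ.* x ℤ.+ y)
  (g≈h (suc j) j≤k) (*ₛ-congˡ≤ (f ∘ suc) k g≈h j (ℕₚ.≤-trans (ℕₚ.n≤1+n j) j≤k))

*ₛ-congʳ≤ : ∀ f {g h} k → g ≈[ k ] h → g *ₛ f ≈[ k ] h *ₛ f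
*ₛ-congʳ≤ f {g} {h} k g≈h j j≤k =
  trans (*ₛ-comm g f j) (trans (*ₛ-congˡ≤ f k g≈h j j≤k) (*ₛ-comm f h j))

*ₛ-zeroˡ : ∀ g → 0ₛ *ₛ g ≗ 0ₛ
*ₛ-zeroˡ g zero    = refl
*ₛ-zeroˡ g (suc k) = trans (ℤₚ.+-identityˡ _) (*ₛ-zeroˡ g k)

*ₛ-identityˡ : ∀ g → 1ₛ *ₛ g ≗ g
*ₛ-identityˡ g zero    = trans (ℤₚ.+-identityʳ _) (ℤₚ.*-identityˡ _)
*ₛ-identityˡ g (suc k) =
  trans (cong₂ ℤ._+_ (ℤₚ.*-identityˡ (g (suc k))) (*ₛ-zeroˡ g k)) (ℤₚ.+-identityʳ _)

*ₛ-distribʳ : ∀ h f g → (f +ₛ g) *ₛ h ≗ f *ₛ h +ₛ g *ₛ h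
*ₛ-distribʳ h f g zero    = IntSolver.solve 3
  (λ h f g → (f :+ g) :* h :+ con 0 := (f :* h :+ con 0) :+ (g :* h :+ con 0)) refl
  (h 0) (f 0) (g 0)
  where open IntSolver
*ₛ-distribʳ h f g (suc k) = trans
  (cong (ℤ._+_ ((f 0 ℤ.+ g 0) ℤ.* h (suc k))) (*ₛ-distribʳ h (f ∘ suc) (g ∘ suc) k))
  (lemma (f 0) (g 0) (h (suc k)) _ _)
  where
  lemma : ∀ f g h x y → (f ℤ.+ g) ℤ.* h ℤ.+ (x ℤ.+ y) ≡ (f ℤ.* h ℤ.+ x) ℤ.+ (g ℤ.* h ℤ.+ y)
  lemma = IntSolver.solve 5
    (λ f g h x y → (f :+ g) :* h :+ (x :+ y) := (f :* h :+ x) :+ (g :* h :+ y)) refl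
    where open IntSolver

*ₛ-scale : ∀ c f g → (λ k → c ℤ.* f k) *ₛ g ≗ (λ k → c ℤ.* (f *ₛ g) k)
*ₛ-scale c f g zero    = IntSolver.solve 3
  (λ c f g → c :* f :* g :+ con 0 := c :* (f :* g :+ con 0)) refl c (f 0) (g 0)
  where open IntSolver
*ₛ-scale c f g (suc k) = trans
  (cong (ℤ._+_ (c ℤ.* f 0 ℤ.* g (suc k))) (*ₛ-scale c (f ∘ suc) g k))
  (lemma c (f 0) (g (suc k)) _)
  where
  lemma : ∀ c f g x → c ℤ.* f ℤ.* g ℤ.+ c ℤ.* x ≡ c ℤ.* (f ℤ.* g ℤ.+ x)
  lemma = IntSolver.solve 4 (λ c f g x → c :* f :* g :+ c :* x := c :* (f :* g :+ x)) refl
    where open IntSolver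

-- The tail of `f *ₛ g` is `f 0` times the tail of `g`, plus `(f ∘ suc) *ₛ g`. Distributivity and
-- scaling separate the two, and the induction is on the degree with `f ∘ suc` in place of `f`.
*ₛ-assoc : ∀ f g h → (f *ₛ g) *ₛ h ≗ f *ₛ (g *ₛ h)
*ₛ-assoc f g h zero    = IntSolver.solve 3
  (λ f g h → (f :* g :+ con 0) :* h :+ con 0 := f :* (g :* h :+ con 0) :+ con 0) refl
  (f 0) (g 0) (h 0)
  where open IntSolver
*ₛ-assoc f g h (suc k) = begin
  (f 0 ℤ.* g 0 ℤ.+ 0ℤ) ℤ.* h (suc k) ℤ.+ (((λ i → f 0 ℤ.* g (suc i)) +ₛ (f ∘ suc) *ₛ g) *ₛ h) k
    ≡⟨ cong (ℤ._+_ ((f 0 ℤ.* g 0 ℤ.+ 0ℤ) ℤ.* h (suc k))) (trans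
         (*ₛ-distribʳ h (λ i → f 0 ℤ.* g (suc i)) ((f ∘ suc) *ₛ g) k)
         (cong₂ ℤ._+_ (*ₛ-scale (f 0) (g ∘ suc) h k) (*ₛ-assoc (f ∘ suc) g h k))) ⟩
  (f 0 ℤ.* g 0 ℤ.+ 0ℤ) ℤ.* h (suc k)
    ℤ.+ (f 0 ℤ.* ((g ∘ suc) *ₛ h) k ℤ.+ ((f ∘ suc) *ₛ (g *ₛ h)) k)
    ≡⟨ lemma (f 0) (g 0) (h (suc k)) _ _ ⟩
  f 0 ℤ.* (g 0 ℤ.* h (suc k) ℤ.+ ((g ∘ suc) *ₛ h) k) ℤ.+ ((f ∘ suc) *ₛ (g *ₛ h)) k ∎
  where
  open ≡-Reasoning
  lemma : ∀ f g h x y →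
    (f ℤ.* g ℤ.+ 0ℤ) ℤ.* h ℤ.+ (f ℤ.* x ℤ.+ y) ≡ f ℤ.* (g ℤ.* h ℤ.+ x) ℤ.+ y
  lemma = IntSolver.solve 5
    (λ f g h x y → (f :* g :+ con 0) :* h :+ (f :* x :+ y) := f :* (g :* h :+ x) :+ y) refl
    where open IntSolver

seriesRing : CommutativeRing 0ℓ 0ℓ
seriesRing = record
  { Carrier = PowerSeries
  ; _≈_ = _≋_
  ; _+_ = _+ₛ_
  ; _*_ = _*ₛ_
  ; -_  = -ₛ_
  ; 0#  = 0ₛ
  ; 1#  = 1ₛ
  ; isCommutativeRing = record
    { isRing = record
      { +-isAbelianGroup = record
        { isGroup = record
          { isMonoid = record
            { isSemigroup = record
              { isMagma = record
                { isEquivalence = record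
                  { refl  = coefficientwise λ _ → refl
                  ; sym   = λ p → coefficientwise λ k → sym (at p k)
                  ; trans = λ p r → coefficientwise λ k → trans (at p k) (at r k)
                  }
                ; ∙-cong = λ p r → coefficientwise λ k → cong₂ ℤ._+_ (at p k) (at r k)
                }
              ; assoc = λ f g h → coefficientwise λ k → ℤₚ.+-assoc (f k) (g k) (h k)
              }
            ; identity = (λ f → coefficientwise λ k → ℤₚ.+-identityˡ (f k))
                       , (λ f → coefficientwise λ k → ℤₚ.+-identityʳ (f k))
            }
          ; inverse = (λ f → coefficientwise λ k → ℤₚ.+-inverseˡ (f k))
                    , (λ f → coefficientwise λ k → ℤₚ.+-inverseʳ (f k))
          ; ⁻¹-cong = λ p → coefficientwise λ k → cong ℤ.-_ (at p k)
          }
        ; comm = λ f g → coefficientwise λ k → ℤₚ.+-comm (f k) (g k)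
        }
      ; *-cong = λ {f} {g} {h} {i} p r → coefficientwise λ k → trans
          (*ₛ-congʳ≤ h k (λ j _ → at p j) k ℕₚ.≤-refl)
          (*ₛ-congˡ≤ g k (λ j _ → at r j) k ℕₚ.≤-refl)
      ; *-assoc = λ f g h → coefficientwise (*ₛ-assoc f g h)
      ; *-identity = (λ f → coefficientwise (*ₛ-identityˡ f))
                   , (λ f → coefficientwise λ k → trans (*ₛ-comm f 1ₛ k) (*ₛ-identityˡ f k))
      ; distrib = (λ f g h → coefficientwise λ k →
                    trans (*ₛ-comm f (g +ₛ h) k)
                      (trans (*ₛ-distribʳ f g h k)
                        (cong₂ ℤ._+_ (*ₛ-comm g f k) (*ₛ-comm h f k))))
                , (λ f g h → coefficientwise (*ₛ-distribʳ f g h))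
      }
    ; *-comm = λ f g → coefficientwise (*ₛ-comm f g)
    }
  }

-- Contiguous relations and telescoping in a commutative semiring

module SemiringLemmas (R : CommutativeSemiring 0ℓ 0ℓ) where
  open CommutativeSemiring R renaming
    ( Carrier to C; _+_ to _⊕_; _*_ to _⊗_; refl to ≈-refl; sym to ≈-sym; trans to ≈-trans )
  open Solver R using (solve; _:+_; _:*_; _:=_; con)
  open SetoidReasoning setoid

  -- Grows at the last term, where telescoping takes place, whereas the finite sums of the theorem
  -- unfold at the first; `∑≡partialSum` reconciles them.
  partialSum : (ℕ → C) → ℕ → C
  partialSum t zero    = 0#
  partialSum t (suc N) = partialSum t N ⊕ t N

  -- Here d = 1/e and d′ = 1/e′ with e′ = e (1 - w), so d = (1 - w) d′.
  inverse-step : ∀ {d d′ e e′ w} → d ⊗ e ≈ 1# → d′ ⊗ e′ ≈ 1# → e′ ⊕ e ⊗ w ≈ e →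
                 d′ ≈ d ⊕ w ⊗ d′
  inverse-step {d} {d′} {e} {e′} {w} de≈1 d′e′≈1 step = begin
    d′                              ≈⟨ *-identityʳ d′ ⟨
    d′ ⊗ 1#                         ≈⟨ *-congˡ de≈1 ⟨
    d′ ⊗ (d ⊗ e)                    ≈⟨ *-congˡ (*-congˡ step) ⟨
    d′ ⊗ (d ⊗ (e′ ⊕ e ⊗ w))         ≈⟨ solve 5 (λ d d′ e e′ w →
      d′ :* (d :* (e′ :+ e :* w)) := d :* (d′ :* e′) :+ w :* (d′ :* (d :* e))) ≈-refl d d′ e e′ w ⟩
    d ⊗ (d′ ⊗ e′) ⊕ w ⊗ (d′ ⊗ (d ⊗ e))
      ≈⟨ +-cong (*-congˡ d′e′≈1) (*-congˡ (*-congˡ de≈1)) ⟩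
    d ⊗ 1# ⊕ w ⊗ (d′ ⊗ 1#)          ≈⟨ +-cong (*-identityʳ d) (*-congˡ (*-identityʳ d′)) ⟩
    d ⊕ w ⊗ d′                      ∎

  -- For the gap series b_{n+1}(m) and b_n(m+2) coincide, both being `a₂`; the relation is its
  -- one-step recurrence with v² y a₂ added on both sides.
  gap-contiguous : ∀ {a₀ a₁ a₂ v y} → a₀ ≈ a₁ ⊕ v ⊗ y ⊗ a₂ →
                   a₀ ⊕ v ⊗ v ⊗ y ⊗ a₂ ≈ a₁ ⊕ (v ⊕ v ⊗ v) ⊗ y ⊗ a₂
  gap-contiguous {a₀} {a₁} {a₂} {v} {y} rec = ≈-trans (+-congʳ rec)
    (solve 4 (λ a₁ a₂ v y → a₁ :+ v :* y :* a₂ :+ v :* v :* y :* a₂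
      := a₁ :+ (v :+ v :* v) :* y :* a₂) ≈-refl a₁ a₂ v y)

  -- Expanding p₀ = (1 + v y)(1 + z v y) p₂ leaves the cross term z v² y² c p₂. Together with v² y
  -- c′ p₂ it makes v² y c p₂, because c′ = c (1 - y z).
  product-contiguous : ∀ {p₀ p₁ p₂ c c′ v y z} →
    p₀ ≈ p₁ ⊕ v ⊗ y ⊗ p₁ → p₁ ≈ p₂ ⊕ z ⊗ v ⊗ y ⊗ p₂ → c′ ⊕ c ⊗ (y ⊗ z) ≈ c →
    c ⊗ p₀ ⊕ v ⊗ v ⊗ y ⊗ (c′ ⊗ p₂) ≈ c ⊗ p₁ ⊕ (v ⊕ v ⊗ v) ⊗ y ⊗ (c ⊗ p₂)
  product-contiguous {p₀} {p₁} {p₂} {c} {c′} {v} {y} {z} rec₀ rec₁ step = begin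
    c ⊗ p₀ ⊕ v ⊗ v ⊗ y ⊗ (c′ ⊗ p₂)
      ≈⟨ +-congʳ (*-congˡ (≈-trans rec₀ (+-congˡ (*-congˡ rec₁)))) ⟩
    c ⊗ (p₁ ⊕ v ⊗ y ⊗ (p₂ ⊕ z ⊗ v ⊗ y ⊗ p₂)) ⊕ v ⊗ v ⊗ y ⊗ (c′ ⊗ p₂)
      ≈⟨ solve 7 (λ p₁ p₂ c c′ v y z →
        c :* (p₁ :+ v :* y :* (p₂ :+ z :* v :* y :* p₂)) :+ v :* v :* y :* (c′ :* p₂)
        := c :* p₁ :+ v :* y :* (c :* p₂) :+ v :* v :* y :* ((c′ :+ c :* (y :* z)) :* p₂))
        ≈-refl p₁ p₂ c c′ v y z ⟩
    c ⊗ p₁ ⊕ v ⊗ y ⊗ (c ⊗ p₂) ⊕ v ⊗ v ⊗ y ⊗ ((c′ ⊕ c ⊗ (y ⊗ z)) ⊗ p₂)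
      ≈⟨ +-congˡ (*-congˡ (*-congʳ step)) ⟩
    c ⊗ p₁ ⊕ v ⊗ y ⊗ (c ⊗ p₂) ⊕ v ⊗ v ⊗ y ⊗ (c ⊗ p₂)
      ≈⟨ solve 5 (λ p₁ p₂ c v y →
        c :* p₁ :+ v :* y :* (c :* p₂) :+ v :* v :* y :* (c :* p₂)
        := c :* p₁ :+ (v :+ v :* v) :* y :* (c :* p₂)) ≈-refl p₁ p₂ c v y ⟩
    c ⊗ p₁ ⊕ (v ⊕ v ⊗ v) ⊗ y ⊗ (c ⊗ p₂) ∎

  module Telescoping
    (x b : ℕ → ℕ → C) (y v : ℕ → C)
    (y₀ : y 0 ≈ 1#)
    (x-shift : ∀ n m → x n (suc m) ≈ y n ⊗ x n m)
    (x-step : ∀ n m → x (suc n) m ≈ v m ⊗ v m ⊗ (y n ⊗ y n) ⊗ x n m ⊕ y (suc n) ⊗ x (suc n) m)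
    (contiguous : ∀ n m → b n m ⊕ v m ⊗ v m ⊗ y n ⊗ b (suc n) m
                        ≈ b n (suc m) ⊕ (v m ⊕ v m ⊗ v m) ⊗ y n ⊗ b n (2 + m))
    where

    t : ℕ → ℕ → C
    t m n = x n m ⊗ b n m

    -- The contiguous relation times `y n ⊗ x n m`. By `x-step` the term with `b (suc n) m` becomes
    -- `t m (suc n)` minus `y (suc n) ⊗ t m (suc n)`; by `x-shift` the factors y and y² on the right
    -- raise m by one and by two.
    term-recurrence : ∀ n m →
      y n ⊗ t m n ⊕ t m (suc n)
        ≈ t (suc m) n ⊕ (v m ⊕ v m ⊗ v m) ⊗ t (2 + m) n ⊕ y (suc n) ⊗ t m (suc n)
    term-recurrence n m = begin
      y n ⊗ (x n m ⊗ b n m) ⊕ x (suc n) m ⊗ b (suc n) m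
        ≈⟨ +-congˡ (*-congʳ (x-step n m)) ⟩
      y n ⊗ (x n m ⊗ b n m) ⊕
        (v m ⊗ v m ⊗ (y n ⊗ y n) ⊗ x n m ⊕ y (suc n) ⊗ x (suc n) m) ⊗ b (suc n) m
        ≈⟨ solve 7 (λ y x b v b′ y′ x′ →
          y :* (x :* b) :+ (v :* v :* (y :* y) :* x :+ y′ :* x′) :* b′
          := y :* x :* (b :+ v :* v :* y :* b′) :+ y′ :* (x′ :* b′)) ≈-refl
          (y n) (x n m) (b n m) (v m) (b (suc n) m) (y (suc n)) (x (suc n) m) ⟩
      y n ⊗ x n m ⊗ (b n m ⊕ v m ⊗ v m ⊗ y n ⊗ b (suc n) m) ⊕ y (suc n) ⊗ t m (suc n)
        ≈⟨ +-congʳ (*-congˡ (contiguous n m)) ⟩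
      y n ⊗ x n m ⊗ (b n (suc m) ⊕ (v m ⊕ v m ⊗ v m) ⊗ y n ⊗ b n (2 + m)) ⊕ y (suc n) ⊗ t m (suc n)
        ≈⟨ +-congʳ (solve 5 (λ y x b₁ s b₂ →
          y :* x :* (b₁ :+ s :* y :* b₂) := y :* x :* b₁ :+ s :* (y :* (y :* x) :* b₂)) ≈-refl
          (y n) (x n m) (b n (suc m)) (v m ⊕ v m ⊗ v m) (b n (2 + m))) ⟩
      y n ⊗ x n m ⊗ b n (suc m) ⊕ (v m ⊕ v m ⊗ v m) ⊗ (y n ⊗ (y n ⊗ x n m) ⊗ b n (2 + m))
        ⊕ y (suc n) ⊗ t m (suc n)
        ≈⟨ +-congʳ (+-cong (*-congʳ (x-shift n m))
            (*-congˡ (*-congʳ (≈-trans (x-shift n (suc m)) (*-congˡ (x-shift n m)))))) ⟨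
      t (suc m) n ⊕ (v m ⊕ v m ⊗ v m) ⊗ t (2 + m) n ⊕ y (suc n) ⊗ t m (suc n) ∎

    -- Summing `term-recurrence` over n < N cancels every `y n ⊗ t m n` with 0 < n < N. The one with
    -- n = 0 is `t m 0`, which completes the sum on the left, and the one with n = N is the
    -- remainder.
    sum-recurrence : ∀ m N →
      partialSum (t m) (suc N)
        ≈ partialSum (t (suc m)) N ⊕ (v m ⊕ v m ⊗ v m) ⊗ partialSum (t (2 + m)) N ⊕ y N ⊗ t m N
    sum-recurrence m zero = begin
      0# ⊕ t m 0           ≈⟨ +-congˡ (≈-trans (≈-sym (*-identityˡ _)) (*-congʳ (≈-sym y₀))) ⟩
      0# ⊕ y 0 ⊗ t m 0     ≈⟨ +-congʳ (≈-trans (≈-sym (+-identityˡ 0#)) (+-congˡ (≈-sym (zeroʳ _)))) ⟩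
      0# ⊕ (v m ⊕ v m ⊗ v m) ⊗ 0# ⊕ y 0 ⊗ t m 0 ∎
    sum-recurrence m (suc N) = begin
      partialSum (t m) (suc N) ⊕ t m (suc N)
        ≈⟨ +-congʳ (sum-recurrence m N) ⟩
      s₁ ⊕ (v m ⊕ v m ⊗ v m) ⊗ s₂ ⊕ y N ⊗ t m N ⊕ t m (suc N)
        ≈⟨ +-assoc _ _ _ ⟩
      s₁ ⊕ (v m ⊕ v m ⊗ v m) ⊗ s₂ ⊕ (y N ⊗ t m N ⊕ t m (suc N))
        ≈⟨ +-congˡ (term-recurrence N m) ⟩
      s₁ ⊕ (v m ⊕ v m ⊗ v m) ⊗ s₂ ⊕
        (t (suc m) N ⊕ (v m ⊕ v m ⊗ v m) ⊗ t (2 + m) N ⊕ y (suc N) ⊗ t m (suc N))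
        ≈⟨ solve 6 (λ s₁ s₂ s t₁ t₂ z →
          s₁ :+ s :* s₂ :+ (t₁ :+ s :* t₂ :+ z) := (s₁ :+ t₁) :+ s :* (s₂ :+ t₂) :+ z) ≈-refl
          s₁ s₂ (v m ⊕ v m ⊗ v m) (t (suc m) N) (t (2 + m) N) (y (suc N) ⊗ t m (suc N)) ⟩
      (s₁ ⊕ t (suc m) N) ⊕ (v m ⊕ v m ⊗ v m) ⊗ (s₂ ⊕ t (2 + m) N) ⊕ y (suc N) ⊗ t m (suc N) ∎
      where
      s₁ = partialSum (t (suc m)) N
      s₂ = partialSum (t (2 + m)) N

open CommutativeRing seriesRing using
  ( setoid; commutativeSemiring; +-cong; *-cong; *-assoc; *-comm
  ; *-identityˡ; *-identityʳ; distribˡ; distribʳ; +-assoc; +-identityʳ; -‿inverseˡ; -‿cong )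
  renaming (refl to ≋-refl; sym to ≋-sym; trans to ≋-trans; reflexive to ≋-reflexive)
open import Algebra.Properties.Ring (CommutativeRing.ring seriesRing)
  using (-‿distribˡ-*; -‿involutive)
open SemiringLemmas commutativeSemiring
module SeriesSolver = Solver commutativeSemiring

-- The library versions take f implicitly, and it cannot be inferred from
-- f *ₛ g, which unfolds.
*-congˡ : ∀ f {g h} → g ≋ h → f *ₛ g ≋ f *ₛ h
*-congˡ f = *-cong (≋-refl {f})

*-congʳ : ∀ f {g h} → g ≋ h → g *ₛ f ≋ h *ₛ f
*-congʳ f g≋h = *-cong g≋h (≋-refl {f})

+-congˡ : ∀ f {g h} → g ≋ h → f +ₛ g ≋ f +ₛ h
+-congˡ f = +-cong (≋-refl {f})

+-congʳ : ∀ f {g h} → g ≋ h → g +ₛ f ≋ h +ₛ f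
+-congʳ f g≋h = +-cong g≋h (≋-refl {f})

q^-cong : ∀ {a b} → a ≡ b → q ^ₛ a ≋ q ^ₛ b
q^-cong refl = ≋-refl

-- Powers of q and Pochhammer symbols

^ₛ-+ : ∀ p a b → p ^ₛ (a + b) ≋ p ^ₛ a *ₛ p ^ₛ b
^ₛ-+ p zero    b = ≋-sym (*-identityˡ _)
^ₛ-+ p (suc a) b = ≋-trans (*-congˡ p (^ₛ-+ p a b)) (≋-sym (*-assoc p (p ^ₛ a) (p ^ₛ b)))

^ₛ-* : ∀ p a n → (p ^ₛ a) ^ₛ n ≋ p ^ₛ (n * a)
^ₛ-* p a zero    = ≋-refl
^ₛ-* p a (suc n) = ≋-trans (*-congˡ (p ^ₛ a) (^ₛ-* p a n)) (≋-sym (^ₛ-+ p a (n * a)))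

*-order : ∀ f g n → (∀ i → i < n → f i ≡ 0ℤ) → ∀ i → i < n → (f *ₛ g) i ≡ 0ℤ
*-order f g n f≡0 i i<n = trans (*ₛ-comm f g i) (*ₛ-order g f n f≡0 i i<n)

q^-order : ∀ n i → i < n → (q ^ₛ n) i ≡ 0ℤ
q^-order = ^ₛ-order q refl

x-xy+xy : ∀ f g → f *ₛ (1ₛ -ₛ g) +ₛ f *ₛ g ≋ f
x-xy+xy f g = begin
  f *ₛ (1ₛ -ₛ g) +ₛ f *ₛ g       ≈⟨ distribˡ f (1ₛ -ₛ g) g ⟨
  f *ₛ (1ₛ +ₛ -ₛ g +ₛ g)         ≈⟨ *-congˡ f (+-assoc 1ₛ (-ₛ g) g) ⟩
  f *ₛ (1ₛ +ₛ (-ₛ g +ₛ g))       ≈⟨ *-congˡ f (+-congˡ 1ₛ (-‿inverseˡ g)) ⟩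
  f *ₛ (1ₛ +ₛ 0ₛ)                ≈⟨ *-congˡ f (+-identityʳ 1ₛ) ⟩
  f *ₛ 1ₛ                        ≈⟨ *-identityʳ f ⟩
  f                              ∎
  where open SetoidReasoning setoid

⟨⨾⟩-step : ∀ x p {w} n → x *ₛ p ^ₛ n ≋ w → ⟨ x ⨾ p ⟩ suc n +ₛ ⟨ x ⨾ p ⟩ n *ₛ w ≋ ⟨ x ⨾ p ⟩ n
⟨⨾⟩-step x p n w≋ =
  ≋-trans (+-congˡ (⟨ x ⨾ p ⟩ suc n) (*-congˡ (⟨ x ⨾ p ⟩ n) (≋-sym w≋))) (x-xy+xy (⟨ x ⨾ p ⟩ n) (x *ₛ p ^ₛ n))

minus-cong : ∀ {f g h i} → f ≋ g → h ≋ i → f -ₛ h ≋ g -ₛ i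
minus-cong f≋g h≋i = coefficientwise λ k → cong₂ ℤ._-_ (at f≋g k) (at h≋i k)

⟨⨾⟩-cong : ∀ {x y} p n → x ≋ y → ⟨ x ⨾ p ⟩ n ≋ ⟨ y ⨾ p ⟩ n
⟨⨾⟩-cong p zero    x≋y = ≋-refl
⟨⨾⟩-cong p (suc n) x≋y = *-cong (⟨⨾⟩-cong p n x≋y) (minus-cong (≋-refl {1ₛ}) (*-congʳ (p ^ₛ n) x≋y))

⟨⨾⟩-unfoldˡ : ∀ x p n → ⟨ x ⨾ p ⟩ suc n ≋ (1ₛ -ₛ x) *ₛ ⟨ x *ₛ p ⨾ p ⟩ n
⟨⨾⟩-unfoldˡ x p zero    = ≋-trans (*-comm 1ₛ (1ₛ -ₛ x *ₛ 1ₛ)) (*-congʳ 1ₛ (minus-cong (≋-refl {1ₛ}) (*-identityʳ x)))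
⟨⨾⟩-unfoldˡ x p (suc n) = ≋-trans
  (*-cong (⟨⨾⟩-unfoldˡ x p n) (minus-cong (≋-refl {1ₛ}) (≋-sym (*-assoc x p (p ^ₛ n)))))
  (*-assoc (1ₛ -ₛ x) (⟨ x *ₛ p ⨾ p ⟩ n) (1ₛ -ₛ (x *ₛ p) *ₛ p ^ₛ n))

⟨⨾⟩∞-unfoldˡ : ∀ {x y} p → p 0 ≡ 0ℤ → x *ₛ p ≋ y → ⟨ x ⨾ p ⟩∞ ≋ (1ₛ -ₛ x) *ₛ ⟨ y ⨾ p ⟩∞
⟨⨾⟩∞-unfoldˡ {x} {y} p p₀ xp≋y = coefficientwise λ k → trans
  -- One factor more than the definition takes: after the first is split off, `suc k` remain, enough
  -- for all coefficients up to k.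
  (sym (⟨⨾⟩-stable x p p₀ k (suc k) (ℕₚ.n<1+n k)))
  (trans (at (≋-trans (⟨⨾⟩-unfoldˡ x p (suc k)) (*-congˡ (1ₛ -ₛ x) (⟨⨾⟩-cong p (suc k) xp≋y))) k)
    (*ₛ-congˡ≤ (1ₛ -ₛ x) k
      (λ j j≤k → proj₂ (⟨⨾⟩⟶⟨⨾⟩∞ y p p₀ j) (suc k) (s≤s j≤k)) k ℕₚ.≤-refl))

P : ℕ → PowerSeries
P m = ⟨ -ₛ (q ^ₛ suc m) ⨾ q ⟩∞

P-step : ∀ m → P m ≋ P (suc m) +ₛ q ^ₛ suc m *ₛ P (suc m)
P-step m = begin
  P m                                        ≈⟨ ⟨⨾⟩∞-unfoldˡ {x = -ₛ (q ^ₛ suc m)} q refl shift-base ⟩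
  (1ₛ +ₛ -ₛ (-ₛ (q ^ₛ suc m))) *ₛ P (suc m)  ≈⟨ *-congʳ (P (suc m)) (+-congˡ 1ₛ (-‿involutive (q ^ₛ suc m))) ⟩
  (1ₛ +ₛ q ^ₛ suc m) *ₛ P (suc m)            ≈⟨ distribʳ (P (suc m)) 1ₛ (q ^ₛ suc m) ⟩
  1ₛ *ₛ P (suc m) +ₛ q ^ₛ suc m *ₛ P (suc m) ≈⟨ +-congʳ (q ^ₛ suc m *ₛ P (suc m)) (*-identityˡ (P (suc m))) ⟩
  P (suc m) +ₛ q ^ₛ suc m *ₛ P (suc m)       ∎
  where
  open SetoidReasoning setoid
  shift-base : -ₛ (q ^ₛ suc m) *ₛ q ≋ -ₛ (q ^ₛ suc (suc m))
  shift-base = ≋-trans (≋-sym (-‿distribˡ-* (q ^ₛ suc m) q)) (-‿cong (*-comm (q ^ₛ suc m) q))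

⟨⨾⟩-truncate : ∀ x p m n → (∀ i → i ≤ m → x i ≡ 0ℤ) → ⟨ x ⨾ p ⟩ n ≈[ m ] 1ₛ
⟨⨾⟩-truncate x p m zero    x≡0 j j≤m = refl
⟨⨾⟩-truncate x p m (suc n) x≡0 j j≤m = trans
  (*ₛ-congˡ≤ (⟨ x ⨾ p ⟩ n) {h = 1ₛ} m
    (λ i i≤m → trans
      (cong (ℤ._-_ (1ₛ i)) (*-order x (p ^ₛ n) (suc m) (λ i i<m → x≡0 i (ℕₚ.≤-pred i<m)) i (s≤s i≤m)))
      (ℤₚ.+-identityʳ (1ₛ i))) j j≤m)
  (trans (at (*-identityʳ (⟨ x ⨾ p ⟩ n)) j) (⟨⨾⟩-truncate x p m n x≡0 j j≤m))

P-truncate : ∀ m → P m ≈[ m ] 1ₛ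
P-truncate m j j≤m = ⟨⨾⟩-truncate (-ₛ (q ^ₛ suc m)) q m (suc j)
  (λ i i≤m → cong ℤ.-_ (q^-order (suc m) i (s≤s i≤m))) j j≤m

-- Gap series

-- The generating function of the partitions into parts m + 1, …, m + d that
-- differ by at least 2.
A≤ : ℕ → ℕ → PowerSeries
A≤ zero          m = 1ₛ
A≤ (suc zero)    m = 1ₛ +ₛ q ^ₛ (m + 1) *ₛ 1ₛ
A≤ (suc (suc d)) m = A≤ (suc d) m +ₛ q ^ₛ (m + suc (suc d)) *ₛ A≤ d m

-- `A≤` decides on the largest allowed part, while the recurrence in m must decide on the smallest,
-- `suc m`. The two decisions commute: both series from the top split are split at the bottom by
-- induction, and `swap` regroups the four terms. The top split reaches back two steps, hence two
-- base cases.
A≤-bottom : ∀ d m → A≤ (suc (suc d)) m ≋ A≤ (suc d) (suc m) +ₛ q ^ₛ suc m *ₛ A≤ d (suc (suc m))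
A≤-bottom zero m = ≋-trans
  (+-cong (+-congˡ 1ₛ (*-congʳ 1ₛ (q^-cong (ℕₚ.+-comm m 1)))) (*-congʳ 1ₛ (q^-cong (ℕₚ.+-suc m 1))))
  (swap 1ₛ (q ^ₛ suc m) (q ^ₛ (suc m + 1)))
  where
  open SeriesSolver
  swap : ∀ o u w → o +ₛ u *ₛ o +ₛ w *ₛ o ≋ o +ₛ w *ₛ o +ₛ u *ₛ o
  swap = solve 3 (λ o u w → o :+ u :* o :+ w :* o := o :+ w :* o :+ u :* o) ≋-refl
A≤-bottom (suc zero) m = ≋-trans
  (+-cong (A≤-bottom zero m)
    (*-cong (q^-cong (ℕₚ.+-suc m 2)) (+-congˡ 1ₛ (*-congʳ 1ₛ (q^-cong (ℕₚ.+-comm m 1))))))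
  (≋-trans (swap 1ₛ (A≤ 1 (suc m)) (q ^ₛ suc m) (q ^ₛ (suc m + 2)))
    (+-congˡ (A≤ 2 (suc m)) (*-congˡ (q ^ₛ suc m)
      (+-congˡ 1ₛ (*-congʳ 1ₛ (q^-cong (ℕₚ.+-suc (suc m) 1)))))))
  where
  open SeriesSolver
  swap : ∀ o a u w →
    a +ₛ u *ₛ o +ₛ w *ₛ (o +ₛ u *ₛ o) ≋ a +ₛ w *ₛ o +ₛ u *ₛ (o +ₛ w *ₛ o)
  swap = solve 4 (λ o a u w →
    a :+ u :* o :+ w :* (o :+ u :* o) := a :+ w :* o :+ u :* (o :+ w :* o)) ≋-refl
A≤-bottom (suc (suc d)) m = ≋-trans
  (+-cong (A≤-bottom (suc d) m) (*-cong (q^-cong (ℕₚ.+-suc m (3 + d))) (A≤-bottom d m)))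
  (≋-trans
    (swap (A≤ (2 + d) (suc m)) (A≤ (suc d) (2 + m)) (A≤ (suc d) (suc m)) (A≤ d (2 + m))
      (q ^ₛ suc m) (q ^ₛ (suc m + (3 + d))))
    (+-congˡ (A≤ (3 + d) (suc m)) (*-congˡ (q ^ₛ suc m)
      (+-congˡ (A≤ (suc d) (2 + m)) (*-congʳ (A≤ d (2 + m)) (q^-cong (ℕₚ.+-suc (suc m) (2 + d))))))))
  where
  open SeriesSolver
  swap : ∀ a b c e u w →
    a +ₛ u *ₛ b +ₛ w *ₛ (c +ₛ u *ₛ e) ≋ a +ₛ w *ₛ c +ₛ u *ₛ (b +ₛ w *ₛ e)
  swap = solve 6 (λ a b c e u w →
    a :+ u :* b :+ w :* (c :+ u :* e) := a :+ w :* c :+ u :* (b :+ w :* e)) ≋-refl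

A≤-stable₁ : ∀ d m k → k ≤ m + d → A≤ (suc d) m k ≡ A≤ d m k
A≤-stable₁ zero m k k≤ = trans
  (cong (ℤ._+_ (1ₛ k)) (*-order (q ^ₛ (m + 1)) 1ₛ (m + 1) (q^-order (m + 1)) k
    (subst (k <_) (sym (ℕₚ.+-suc m 0)) (s≤s k≤))))
  (ℤₚ.+-identityʳ (1ₛ k))
A≤-stable₁ (suc d) m k k≤ = trans
  (cong (ℤ._+_ (A≤ (suc d) m k))
    (*-order (q ^ₛ (m + suc (suc d))) (A≤ d m) (m + suc (suc d)) (q^-order _) k
      (subst (k <_) (sym (ℕₚ.+-suc m (suc d))) (s≤s k≤))))
  (ℤₚ.+-identityʳ (A≤ (suc d) m k))

A≤-stable : ∀ e d m k → k ≤ m + d → A≤ (e + d) m k ≡ A≤ d m k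
A≤-stable zero    d m k k≤ = refl
A≤-stable (suc e) d m k k≤ = trans
  (A≤-stable₁ (e + d) m k (ℕₚ.≤-trans k≤ (ℕₚ.+-monoʳ-≤ m (ℕₚ.m≤n+m d e))))
  (A≤-stable e d m k k≤)

-- In degree k, parts up to m + k suffice; any larger bound gives the same coefficient, see
-- `A≤-limit`.
A : ℕ → PowerSeries
A m k = A≤ k m k

A≤-limit : ∀ d m k → k ≤ d → A≤ d m k ≡ A m k
A≤-limit d m k k≤d = subst (λ e → A≤ e m k ≡ A m k) (ℕₚ.m∸n+n≡m k≤d)
  (A≤-stable (d ∸ k) k m k (ℕₚ.m≤n+m k m))

A-step : ∀ m → A m ≋ A (suc m) +ₛ q ^ₛ suc m *ₛ A (2 + m)
A-step m = coefficientwise λ k → trans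
  (sym (A≤-limit (2 + k) m k (ℕₚ.m≤n+m k 2)))
  (trans (at (A≤-bottom k m) k)
    (cong₂ ℤ._+_ (A≤-limit (suc k) (suc m) k (ℕₚ.n≤1+n k))
      (*ₛ-congˡ≤ (q ^ₛ suc m) k (λ j j≤k → A≤-limit k (2 + m) j j≤k) k ℕₚ.≤-refl)))

A-truncate : ∀ m → A m ≈[ m ] 1ₛ
A-truncate m k k≤m = subst (λ d → A≤ d m k ≡ 1ₛ k) (ℕₚ.+-identityʳ k)
  (A≤-stable k 0 m k (ℕₚ.≤-trans k≤m (ℕₚ.m≤m+n m 0)))

-- The summands

y : ℕ → PowerSeries
y n = q ^ₛ (2 * n)

v : ℕ → PowerSeries
v m = q ^ₛ suc m

c : ℕ → PowerSeries
c n = ⟨ q ⨾ q ^ₛ 2 ⟩ n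

E : ℕ → PowerSeries
E n = ⟨ q ^ₛ 2 ⨾ q ^ₛ 2 ⟩ n

E⁻¹ : ℕ → PowerSeries
E⁻¹ n = 1ₛ /ₛ E n

x : ℕ → ℕ → PowerSeries
x n m = q ^ₛ (2 * n * (n + m)) *ₛ E⁻¹ n

E⁻¹-inverse : ∀ n → E⁻¹ n *ₛ E n ≋ 1ₛ
E⁻¹-inverse n = coefficientwise (/ₛ-*ₛ 1ₛ (E n) (⟨⨾⟩-constant (q ^ₛ 2) (q ^ₛ 2) n refl))

c-step : ∀ n → c (suc n) +ₛ c n *ₛ (y n *ₛ q) ≋ c n
c-step n = ⟨⨾⟩-step q (q ^ₛ 2) n
  (≋-trans (*-congˡ q (≋-trans (^ₛ-* q 2 n) (q^-cong (ℕₚ.*-comm n 2)))) (*-comm q (y n)))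

E-step : ∀ n → E (suc n) +ₛ E n *ₛ y (suc n) ≋ E n
E-step n = ⟨⨾⟩-step (q ^ₛ 2) (q ^ₛ 2) n
  (≋-trans (^ₛ-* q 2 (suc n)) (q^-cong (ℕₚ.*-comm (suc n) 2)))

x-shift : ∀ n m → x n (suc m) ≋ y n *ₛ x n m
x-shift n m = ≋-trans
  (*-congʳ (E⁻¹ n) (≋-trans (q^-cong (exponent n m)) (^ₛ-+ q (2 * n) (2 * n * (n + m)))))
  (*-assoc (y n) (q ^ₛ (2 * n * (n + m))) (E⁻¹ n))
  where
  exponent : ∀ n m → 2 * n * (n + suc m) ≡ 2 * n + 2 * n * (n + m)
  exponent = ℕ-Solver.solve-∀

-- The exponent 2n(n + m) grows by 2(m + 1) + 4n from n to n + 1, which accounts for v² y²; the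
-- denominator gains the factor 1 - q^(2n+2), written here without subtraction.
x-step : ∀ n m → x (suc n) m ≋ v m *ₛ v m *ₛ (y n *ₛ y n) *ₛ x n m +ₛ y (suc n) *ₛ x (suc n) m
x-step n m = begin
  e′ *ₛ E⁻¹ (suc n)
    ≈⟨ *-congˡ e′ (inverse-step {E⁻¹ n} {E⁻¹ (suc n)} {E n} {E (suc n)} {y (suc n)} (E⁻¹-inverse n) (E⁻¹-inverse (suc n)) (E-step n)) ⟩
  e′ *ₛ (E⁻¹ n +ₛ y (suc n) *ₛ E⁻¹ (suc n))
    ≈⟨ distribˡ e′ (E⁻¹ n) (y (suc n) *ₛ E⁻¹ (suc n)) ⟩
  e′ *ₛ E⁻¹ n +ₛ e′ *ₛ (y (suc n) *ₛ E⁻¹ (suc n))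
    ≈⟨ +-cong (*-congʳ (E⁻¹ n) e′≋) (swap e′ (y (suc n)) (E⁻¹ (suc n))) ⟩
  v m *ₛ v m *ₛ (y n *ₛ y n) *ₛ e *ₛ E⁻¹ n +ₛ y (suc n) *ₛ (e′ *ₛ E⁻¹ (suc n))
    ≈⟨ +-congʳ (y (suc n) *ₛ (e′ *ₛ E⁻¹ (suc n))) (*-assoc (v m *ₛ v m *ₛ (y n *ₛ y n)) e (E⁻¹ n)) ⟩
  v m *ₛ v m *ₛ (y n *ₛ y n) *ₛ x n m +ₛ y (suc n) *ₛ x (suc n) m ∎
  where
  open SetoidReasoning setoid
  open SeriesSolver
  e e′ : PowerSeries
  e  = q ^ₛ (2 * n * (n + m))
  e′ = q ^ₛ (2 * suc n * (suc n + m))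
  exponent : ∀ n m →
    2 * suc n * (suc n + m) ≡ suc m + suc m + (2 * n + 2 * n) + 2 * n * (n + m)
  exponent = ℕ-Solver.solve-∀
  e′≋ : e′ ≋ v m *ₛ v m *ₛ (y n *ₛ y n) *ₛ e
  e′≋ = ≋-trans (q^-cong (exponent n m))
    (≋-trans (^ₛ-+ q (suc m + suc m + (2 * n + 2 * n)) (2 * n * (n + m)))
      (*-congʳ e (≋-trans (^ₛ-+ q (suc m + suc m) (2 * n + 2 * n))
        (*-cong (^ₛ-+ q (suc m) (suc m)) (^ₛ-+ q (2 * n) (2 * n))))))
  swap : ∀ f g h → f *ₛ (g *ₛ h) ≋ g *ₛ (f *ₛ h)
  swap = solve 3 (λ f g h → f :* (g :* h) := g :* (f :* h)) ≋-refl

-- The two families of solutions of the contiguous relation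

gapTerm productTerm : ℕ → ℕ → PowerSeries
gapTerm     n m = A (m + 2 * n)
productTerm n m = c n *ₛ P (m + 2 * n)

Contiguous : (ℕ → ℕ → PowerSeries) → Set
Contiguous b = ∀ n m →
  b n m +ₛ v m *ₛ v m *ₛ y n *ₛ b (suc n) m
    ≋ b n (suc m) +ₛ (v m +ₛ v m *ₛ v m) *ₛ y n *ₛ b n (2 + m)

m+2[1+n] : ∀ m n → m + 2 * suc n ≡ 2 + m + 2 * n
m+2[1+n] = ℕ-Solver.solve-∀

gap-solves : Contiguous gapTerm
gap-solves n m = subst
  (λ k → A (m + 2 * n) +ₛ v m *ₛ v m *ₛ y n *ₛ A k
    ≋ A (suc m + 2 * n) +ₛ (v m +ₛ v m *ₛ v m) *ₛ y n *ₛ A (2 + m + 2 * n))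
  (sym (m+2[1+n] m n))
  (gap-contiguous {A (m + 2 * n)} {A (suc m + 2 * n)} {A (2 + m + 2 * n)} {v m} {y n}
    (≋-trans (A-step (m + 2 * n)) (+-congˡ (A (suc m + 2 * n))
      (*-congʳ (A (2 + m + 2 * n)) (^ₛ-+ q (suc m) (2 * n))))))

-- The case z = q: the second of the two factors split off `P (m + 2 * n)` is 1 + q v y, and c_{n+1}
-- = c_n (1 - q y). This is how the base q² of (q;q²)_n fits the double steps of `P`.
product-solves : Contiguous productTerm
product-solves n m = subst
  (λ k → c n *ₛ P (m + 2 * n) +ₛ v m *ₛ v m *ₛ y n *ₛ (c (suc n) *ₛ P k)
    ≋ c n *ₛ P (suc m + 2 * n) +ₛ (v m +ₛ v m *ₛ v m) *ₛ y n *ₛ (c n *ₛ P (2 + m + 2 * n)))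
  (sym (m+2[1+n] m n))
  (product-contiguous
    {P (m + 2 * n)} {P (suc m + 2 * n)} {P (2 + m + 2 * n)} {c n} {c (suc n)} {v m} {y n} {q}
    (≋-trans (P-step (m + 2 * n)) (+-congˡ (P (suc m + 2 * n))
      (*-congʳ (P (suc m + 2 * n)) (^ₛ-+ q (suc m) (2 * n)))))
    (≋-trans (P-step (suc m + 2 * n)) (+-congˡ (P (2 + m + 2 * n))
      (*-congʳ (P (2 + m + 2 * n)) (≋-trans (^ₛ-+ q (2 + m) (2 * n)) (≋-refl {q *ₛ v m *ₛ y n})))))
    (c-step n))

-- Coefficients of the partial sums

x-order : ∀ n m i → i < 2 * n * (n + m) → x n m i ≡ 0ℤ
x-order n m = *-order (q ^ₛ (2 * n * (n + m))) (E⁻¹ n) (2 * n * (n + m)) (q^-order (2 * n * (n + m)))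

x₀ : ∀ m → x 0 m ≋ 1ₛ
x₀ m = ≋-trans (*-identityˡ (E⁻¹ 0)) (≋-trans (≋-sym (*-identityʳ (E⁻¹ 0))) (E⁻¹-inverse 0))

module Sums (b : ℕ → ℕ → PowerSeries) (contiguous : Contiguous b) where

  open Telescoping x b y v ≋-refl x-shift x-step contiguous public

  S : ℕ → ℕ → PowerSeries
  S m = partialSum (t m)

  -- A bound weaker than 2n(n + m) that serves two purposes: it is at least n, so partial sums
  -- stabilise, and it exceeds m once n ≥ 1, so only the term n = 0 matters up to degree m.
  t-order : ∀ m n i → i < n + n * m → t m n i ≡ 0ℤ
  t-order m n i i< = *-order (x n m) (b n m) (suc i)
    (λ j j<1+i → x-order n m j (ℕₚ.<-≤-trans (ℕₚ.≤-<-trans (ℕₚ.≤-pred j<1+i) i<) (bound n)))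
    i (ℕₚ.n<1+n i)
    where
    bound : ∀ n → n + n * m ≤ 2 * n * (n + m)
    bound zero    = z≤n
    bound (suc n) = ℕₚ.≤-trans (ℕₚ.m≤m+n _ _) (ℕₚ.≤-reflexive (sym (expand n m)))
      where
      expand : ∀ n m → 2 * suc n * (suc n + m)
        ≡ suc n + suc n * m + (suc n * m + suc n + 2 * n + 2 * n * n)
      expand = ℕ-Solver.solve-∀

  S-stable : ∀ m N k → k < N → S m (suc N) k ≡ S m N k
  S-stable m N k k<N = trans
    (cong (ℤ._+_ (S m N k)) (t-order m N k (ℕₚ.<-≤-trans k<N (ℕₚ.m≤m+n N (N * m)))))
    (ℤₚ.+-identityʳ (S m N k))

  S-recurrence : ∀ m N k → k < N →
    S m N k ≡ S (suc m) N k ℤ.+ ((v m +ₛ v m *ₛ v m) *ₛ S (2 + m) N) k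
  -- Lengthening the left sum by one term does not affect degree k < N, and neither does the
  -- remainder `y N *ₛ t m N`.
  S-recurrence m N k k<N = trans (sym (S-stable m N k k<N)) (trans (at (sum-recurrence m N) k)
    (trans (cong (ℤ._+_ (S (suc m) N k ℤ.+ ((v m +ₛ v m *ₛ v m) *ₛ S (2 + m) N) k))
        (*ₛ-order (y N) (t m N) (suc k)
          (λ i i≤k → t-order m N i
            (ℕₚ.<-≤-trans (ℕₚ.≤-<-trans (ℕₚ.≤-pred i≤k) k<N) (ℕₚ.m≤m+n N (N * m))))
          k (ℕₚ.n<1+n k)))
      (ℤₚ.+-identityʳ _)))

  S-truncate : (∀ m → b 0 m ≈[ m ] 1ₛ) → ∀ m N → S m (suc N) ≈[ m ] 1ₛ
  S-truncate b₀ m zero k k≤m = trans (ℤₚ.+-identityˡ (t m 0 k))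
    (trans (at (≋-trans (*-congʳ (b 0 m) (x₀ m)) (*-identityˡ (b 0 m))) k) (b₀ m k k≤m))
  S-truncate b₀ m (suc N) k k≤m = trans
    (cong (ℤ._+_ (S m (suc N) k)) (t-order m (suc N) k
      (ℕₚ.≤-<-trans k≤m (s≤s (ℕₚ.≤-trans (ℕₚ.m≤m+n m (N * m)) (ℕₚ.m≤n+m _ N))))))
    (trans (ℤₚ.+-identityʳ _) (S-truncate b₀ m N k k≤m))

-- The recurrence of the sums, together with their initial coefficients,
-- determines every coefficient, because it increases m.
sums-agree : ∀ b b′ (p : Contiguous b) (p′ : Contiguous b′) →
  (∀ m → b 0 m ≈[ m ] 1ₛ) → (∀ m → b′ 0 m ≈[ m ] 1ₛ) →
  ∀ d m N k → k ≤ m + d → k < N → Sums.S b p m N k ≡ Sums.S b′ p′ m N k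
sums-agree b b′ p p′ b₀ b₀′ zero m (suc N) k k≤ _ = trans
  (Sums.S-truncate b p b₀ m N k k≤m) (sym (Sums.S-truncate b′ p′ b₀′ m N k k≤m))
  where
  k≤m : k ≤ m
  k≤m = subst (k ≤_) (ℕₚ.+-identityʳ m) k≤
-- d bounds how far m still is below k. Raising m by one or two pays for lowering d by one; at d = 0
-- both coefficients are those of 1.
sums-agree b b′ p p′ b₀ b₀′ (suc d) m N k k≤ k<N = begin
  Sums.S b p m N k
    ≡⟨ Sums.S-recurrence b p m N k k<N ⟩
  Sums.S b p (suc m) N k ℤ.+ ((v m +ₛ v m *ₛ v m) *ₛ Sums.S b p (2 + m) N) k
    ≡⟨ cong₂ ℤ._+_ (agree (suc m) k k≤′ k<N)
         (*ₛ-congˡ≤ (v m +ₛ v m *ₛ v m) k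
           (λ j j≤k → agree (2 + m) j (ℕₚ.m≤n⇒m≤1+n (ℕₚ.≤-trans j≤k k≤′)) (ℕₚ.≤-<-trans j≤k k<N))
           k ℕₚ.≤-refl) ⟩
  Sums.S b′ p′ (suc m) N k ℤ.+ ((v m +ₛ v m *ₛ v m) *ₛ Sums.S b′ p′ (2 + m) N) k
    ≡⟨ Sums.S-recurrence b′ p′ m N k k<N ⟨
  Sums.S b′ p′ m N k ∎
  where
  open ≡-Reasoning
  k≤′ : k ≤ suc m + d
  k≤′ = subst (k ≤_) (ℕₚ.+-suc m d) k≤
  agree : ∀ m′ j → j ≤ m′ + d → j < N → Sums.S b p m′ N j ≡ Sums.S b′ p′ m′ N j
  agree m′ j = sums-agree b b′ p p′ b₀ b₀′ d m′ N j

gap≡product : ∀ N k → k < N →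
  Sums.S gapTerm gap-solves 1 N k ≡ Sums.S productTerm product-solves 1 N k
gap≡product N k = sums-agree gapTerm productTerm gap-solves product-solves
  (λ m → subst (λ j → A j ≈[ m ] 1ₛ) (sym (ℕₚ.+-identityʳ m)) (A-truncate m))
  (λ m k k≤m → trans (at (*-identityˡ (P (m + 0))) k)
    (P-truncate (m + 0) k (ℕₚ.≤-trans k≤m (ℕₚ.m≤m+n m 0))))
  k 1 N k (ℕₚ.n≤1+n k)

-- Long division is accessible only through `/ₛ-*ₛ`; inserting `E⁻¹ n *ₛ E n` turns it into
-- multiplication by `E⁻¹ n`.
term-quotient : ∀ n →
  (q ^ₛ (2 * n * (n + 1)) *ₛ ⟨ q ⨾ q ^ₛ 2 ⟩ n *ₛ ⟨ -ₛ (q ^ₛ (2 * n + 2)) ⨾ q ⟩∞) /ₛ ⟨ q ^ₛ 2 ⨾ q ^ₛ 2 ⟩ n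
    ≋ x n 1 *ₛ productTerm n 1
term-quotient n = begin
  f /ₛ E n                          ≈⟨ *-identityʳ (f /ₛ E n) ⟨
  (f /ₛ E n) *ₛ 1ₛ                  ≈⟨ *-congˡ (f /ₛ E n) (E⁻¹-inverse n) ⟨
  (f /ₛ E n) *ₛ (E⁻¹ n *ₛ E n)      ≈⟨ swap (f /ₛ E n) (E⁻¹ n) (E n) ⟩
  (f /ₛ E n) *ₛ E n *ₛ E⁻¹ n
    ≈⟨ *-congʳ (E⁻¹ n) (coefficientwise
         (/ₛ-*ₛ f (E n) (⟨⨾⟩-constant (q ^ₛ 2) (q ^ₛ 2) n refl))) ⟩
  f *ₛ E⁻¹ n
    ≈⟨ *-congʳ (E⁻¹ n) (*-congˡ (q ^ₛ (2 * n * (n + 1)) *ₛ c n)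
         (≋-reflexive (cong (λ j → ⟨ -ₛ (q ^ₛ j) ⨾ q ⟩∞) (ℕₚ.+-comm (2 * n) 2)))) ⟩
  q ^ₛ (2 * n * (n + 1)) *ₛ c n *ₛ P (suc (2 * n)) *ₛ E⁻¹ n
    ≈⟨ rearrange (q ^ₛ (2 * n * (n + 1))) (c n) (P (suc (2 * n))) (E⁻¹ n) ⟩
  x n 1 *ₛ productTerm n 1          ∎
  where
  open SetoidReasoning setoid
  open SeriesSolver
  f : PowerSeries
  f = q ^ₛ (2 * n * (n + 1)) *ₛ c n *ₛ ⟨ -ₛ (q ^ₛ (2 * n + 2)) ⨾ q ⟩∞
  swap : ∀ f g h → f *ₛ (g *ₛ h) ≋ f *ₛ h *ₛ g
  swap = solve 3 (λ f g h → f :* (g :* h) := f :* h :* g) ≋-refl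
  rearrange : ∀ f g h i → f *ₛ g *ₛ h *ₛ i ≋ f *ₛ i *ₛ (g *ₛ h)
  rearrange = solve 4 (λ f g h i → f :* g :* h :* i := f :* i :* (g :* h)) ≋-refl

-- Shapes of admissible partitions

mult-∷-≡ : ∀ x xs → mult x (x ∷ xs) ≡ suc (mult x xs)
mult-∷-≡ x xs = cong length (filter-accept (x ℕₚ.≟_) {xs = xs} refl)

mult-∷-≢ : ∀ {j x} xs → j ≢ x → mult j (x ∷ xs) ≡ mult j xs
mult-∷-≢ {j} xs j≢x = cong length (filter-reject (j ℕₚ.≟_) {xs = xs} j≢x)

mult-∷-≤ : ∀ j x xs → mult j xs ≤ mult j (x ∷ xs)
mult-∷-≤ j x xs with j ℕₚ.≟ x
... | yes refl = ℕₚ.≤-trans (ℕₚ.n≤1+n _) (ℕₚ.≤-reflexive (sym (mult-∷-≡ j xs)))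
... | no  j≢x  = ℕₚ.≤-reflexive (sym (mult-∷-≢ xs j≢x))

∉⇒mult≡0 : ∀ {j xs} → j ∉ xs → mult j xs ≡ 0
∉⇒mult≡0 {j} {xs} j∉xs = cong length
  (filter-none (j ℕₚ.≟_) (All.tabulate λ x∈xs j≡x → j∉xs (subst (_∈ xs) (sym j≡x) x∈xs)))

∈⇒0<mult : ∀ {j xs} → j ∈ xs → 0 < mult j xs
∈⇒0<mult {j} {_ ∷ xs} (here refl) = subst (0 <_) (sym (mult-∷-≡ j xs)) (s≤s z≤n)
∈⇒0<mult {j} {x ∷ xs} (there j∈) = ℕₚ.<-≤-trans (∈⇒0<mult j∈) (mult-∷-≤ j x xs)

0<mult⇒∈ : ∀ {j xs} → 0 < mult j xs → j ∈ xs
0<mult⇒∈ {j} {xs} 0<m with j ∈? xs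
... | yes j∈ = j∈
... | no  j∉ = contradiction (subst (0 <_) (∉⇒mult≡0 j∉) 0<m) ℕₚ.n≮0

-- The bottom of an admissible partition with R₁ = 2r: the parts 2, 4, …, 2r,
-- each at least twice.
data Chain : ℕ → List ℕ → Set where
  []   : Chain 0 []
  two  : ∀ {r xs} → Chain r xs → Chain (suc r) (2 * suc r ∷ 2 * suc r ∷ xs)
  more : ∀ {r xs} → Chain (suc r) xs → Chain (suc r) (2 * suc r ∷ xs)

-- A chain below a list of parts 2r + 1 < p ≤ 2r + 1 + d that differ by at least 2.
data Flat (r : ℕ) : ℕ → List ℕ → Set where
  chain : ∀ {xs} → Chain r xs → Flat r 0 xs
  keep  : ∀ {d xs} → Flat r d xs → Flat r (suc d) xs
  one   : ∀ {xs} → Chain r xs → Flat r 1 (1 + 2 * r + 1 ∷ xs)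
  add   : ∀ {d xs} → Flat r d xs → Flat r (2 + d) (1 + 2 * r + (2 + d) ∷ xs)

record ChainShape (r : ℕ) (xs : List ℕ) : Set where
  constructor mkChainShape
  field
    decreasing : AllPairs _≥_ xs
    positive   : All (0 <_) xs
    even       : All (2 ∣_) xs
    bounded    : All (_≤ 2 * r) xs
    repeated   : ∀ i → i < r → 2 ≤ mult (2 * suc i) xs

-- Halfway between admissibility and the inductive `Flat`: r is explicit, and `R₁` is replaced by
-- conditions on multiplicities that survive removing a large head.
record Shape (r : ℕ) (xs : List ℕ) : Set where
  constructor mkShape
  field
    decreasing     : AllPairs _≥_ xs
    positive       : All (0 <_) xs
    low-even       : ∀ j → j ∈ xs → j ≤ 1 + 2 * r → 2 ∣ j
    low-repeated   : ∀ i → i < r → 2 ≤ mult (2 * suc i) xs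
    high-single    : ∀ j → 2 * r < j → mult j xs ≤ 1
    no-consecutive : ∀ j → ¬ (j ∈ xs × suc j ∈ xs)

0<2[1+r] : ∀ r → 0 < 2 * suc r
0<2[1+r] r = s≤s z≤n

2r≤2[1+r] : ∀ r → 2 * r ≤ 2 * suc r
2r≤2[1+r] r = ℕₚ.*-monoʳ-≤ 2 (ℕₚ.n≤1+n r)

2r<2[1+r] : ∀ r → 2 * r < 2 * suc r
2r<2[1+r] r = ℕₚ.*-monoʳ-< 2 (ℕₚ.n<1+n r)

<⇒2[1+i]≢ : ∀ {i r} → i < r → 2 * suc i ≢ 2 * suc r
<⇒2[1+i]≢ i<r = ℕₚ.<⇒≢ (ℕₚ.*-monoʳ-< 2 (s≤s i<r))

chain⇒shape : ∀ {r xs} → Chain r xs → ChainShape r xs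
chain⇒shape [] = mkChainShape [] [] [] [] (λ i ())
chain⇒shape (two {r} {xs} c) with chain⇒shape c
... | mkChainShape dec pos even bdd rep = mkChainShape
  ((ℕₚ.≤-refl ∷ bdd′) ∷ bdd′ ∷ dec)
  (0<2[1+r] r ∷ 0<2[1+r] r ∷ pos)
  (m∣m*n (suc r) ∷ m∣m*n (suc r) ∷ even)
  (ℕₚ.≤-refl ∷ ℕₚ.≤-refl ∷ bdd′)
  rep′
  where
  a = 2 * suc r
  bdd′ : All (_≤ a) xs
  bdd′ = All.map (λ y≤ → ℕₚ.≤-trans y≤ (2r≤2[1+r] r)) bdd
  rep′ : ∀ i → i < suc r → 2 ≤ mult (2 * suc i) (a ∷ a ∷ xs)
  rep′ i i<1+r with i ℕₚ.≟ r
  ... | yes refl = subst (2 ≤_)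
    (sym (trans (mult-∷-≡ a (a ∷ xs)) (cong suc (mult-∷-≡ a xs)))) (s≤s (s≤s z≤n))
  ... | no  i≢r  = ℕₚ.≤-trans (rep i (ℕₚ.≤∧≢⇒< (ℕₚ.≤-pred i<1+r) i≢r))
    (ℕₚ.≤-trans (mult-∷-≤ (2 * suc i) a xs) (mult-∷-≤ (2 * suc i) a (a ∷ xs)))
chain⇒shape (more {r} {xs} c) with chain⇒shape c
... | mkChainShape dec pos even bdd rep = mkChainShape
  (bdd ∷ dec) (0<2[1+r] r ∷ pos) (m∣m*n (suc r) ∷ even) (ℕₚ.≤-refl ∷ bdd)
  (λ i i<1+r → ℕₚ.≤-trans (rep i i<1+r) (mult-∷-≤ (2 * suc i) (2 * suc r) xs))

≤2[1+r]∧≢⇒≤2r : ∀ {y} r → 2 ∣ y → y ≤ 2 * suc r → y ≢ 2 * suc r → y ≤ 2 * r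
≤2[1+r]∧≢⇒≤2r r (divides h refl) y≤ y≢ = subst (h * 2 ≤_) (ℕₚ.*-comm r 2)
  (ℕₚ.*-monoˡ-≤ 2 (ℕₚ.≤-pred (ℕₚ.≤∧≢⇒<
    (ℕₚ.*-cancelʳ-≤ h (suc r) 2 (subst (h * 2 ≤_) (ℕₚ.*-comm 2 (suc r)) y≤))
    (λ h≡ → y≢ (trans (cong (_* 2) h≡) (ℕₚ.*-comm (suc r) 2))))))

head-≡ : ∀ {a x xs} → AllPairs _≥_ (x ∷ xs) → x ≤ a → a ∈ x ∷ xs → x ≡ a
head-≡ _         _   (here a≡x) = sym a≡x
head-≡ (x≥ ∷ _) x≤a (there a∈) = ℕₚ.≤-antisym x≤a (All.lookup x≥ a∈)

-- For r > 0 the value 2r bounds all parts and occurs, so it heads the list. `go` has one copy in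
-- hand and one guaranteed in the rest; whether yet another follows decides between `two` and
-- `more`.
shape⇒chain : ∀ r xs → ChainShape r xs → Chain r xs
shape⇒chain zero    []      _ = []
shape⇒chain zero    (x ∷ _) (mkChainShape _ (0<x ∷ _) _ (x≤0 ∷ _) _) =
  contradiction (ℕₚ.<-≤-trans 0<x x≤0) ℕₚ.n≮0
shape⇒chain (suc r) []      (mkChainShape _ _ _ _ rep) with rep r (ℕₚ.n<1+n r)
... | ()
shape⇒chain (suc r) (x ∷ xs) (mkChainShape dec@(x≥ ∷ dec′) (_ ∷ pos) (_ ∷ even) (x≤ ∷ bdd) rep)
  with head-≡ dec x≤ (0<mult⇒∈ (ℕₚ.<-trans (s≤s z≤n) (rep r (ℕₚ.n<1+n r))))
... | refl = go xs dec′ pos even bdd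
               (ℕₚ.≤-pred (subst (2 ≤_) (mult-∷-≡ x xs) (rep r (ℕₚ.n<1+n r))))
               (λ i i<r → subst (2 ≤_)
                 (mult-∷-≢ xs (<⇒2[1+i]≢ i<r))
                 (rep i (ℕₚ.m<n⇒m<1+n i<r)))
  where
  a = 2 * suc r
  go : ∀ ys → AllPairs _≥_ ys → All (0 <_) ys → All (2 ∣_) ys → All (_≤ a) ys →
       1 ≤ mult a ys → (∀ i → i < r → 2 ≤ mult (2 * suc i) ys) → Chain (suc r) (a ∷ ys)
  go (y ∷ ys) dec@(_ ∷ dec′) (0<y ∷ pos) (2∣y ∷ even) (y≤ ∷ bdd) 1≤ rep
    with head-≡ dec y≤ (0<mult⇒∈ 1≤)
  ... | refl with a ∈? ys
  ...   | no a∉ = two (shape⇒chain r ys (mkChainShape dec′ pos even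
            (All.tabulate λ {z} z∈ → ≤2[1+r]∧≢⇒≤2r r (All.lookup even z∈) (All.lookup bdd z∈)
              λ z≡ → a∉ (subst (_∈ ys) z≡ z∈))
            (λ i i<r → subst (2 ≤_)
              (mult-∷-≢ ys (<⇒2[1+i]≢ i<r))
              (rep i i<r))))
  ...   | yes a∈ = more (go ys dec′ pos even bdd (∈⇒0<mult a∈)
            (λ i i<r → subst (2 ≤_)
              (mult-∷-≢ ys (<⇒2[1+i]≢ i<r))
              (rep i i<r)))

chainShape⇒shape : ∀ {r xs} → ChainShape r xs → Shape r xs
chainShape⇒shape {r} (mkChainShape dec pos even bdd rep) = mkShape dec pos
  (λ j j∈ _ → All.lookup even j∈)
  rep
  (λ j 2r<j → ℕₚ.≤-trans
    (ℕₚ.≤-reflexive (∉⇒mult≡0 λ j∈ → ℕₚ.<⇒≱ 2r<j (All.lookup bdd j∈))) z≤n)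
  (λ { j (j∈ , 1+j∈) → contradiction
    (∣1⇒≡1 (∣m+n∣m⇒∣n (subst (2 ∣_) (ℕₚ.+-comm 1 j) (All.lookup even 1+j∈)) (All.lookup even j∈)))
    λ () })

shape⇒chainShape : ∀ {r xs} → Shape r xs → All (_≤ 1 + 2 * r) xs → ChainShape r xs
shape⇒chainShape {r} (mkShape dec pos low-even rep _ _) bdd = mkChainShape dec pos
  (All.tabulate λ {j} j∈ → low-even j j∈ (All.lookup bdd j∈))
  (All.tabulate λ {j} j∈ → ≤2r (low-even j j∈ (All.lookup bdd j∈)) (All.lookup bdd j∈))
  rep
  where
  ≤2r : ∀ {j} → 2 ∣ j → j ≤ 1 + 2 * r → j ≤ 2 * r
  ≤2r 2∣j j≤ = ≤2[1+r]∧≢⇒≤2r r 2∣j (ℕₚ.≤-trans j≤ (2r<2[1+r] r))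
    (λ j≡ → ℕₚ.<⇒≱ (subst (1 + 2 * r <_) (sym (trans j≡ (ℕₚ.*-suc 2 r))) ℕₚ.≤-refl) j≤)

shape-∷ : ∀ {r x xs} → 1 + 2 * r < x → All (λ z → 2 + z ≤ x) xs → Shape r xs → Shape r (x ∷ xs)
shape-∷ {r} {x} {xs} 2r+1<x gap (mkShape dec pos low-even rep single apart) = mkShape
  (All.map (λ p → ℕₚ.≤-trans (ℕₚ.m≤n+m _ 2) p) gap ∷ dec)
  (ℕₚ.≤-<-trans z≤n 2r+1<x ∷ pos)
  low-even′
  (λ i i<r → ℕₚ.≤-trans (rep i i<r) (mult-∷-≤ (2 * suc i) x xs))
  single′
  apart′
  where
  low-even′ : ∀ j → j ∈ x ∷ xs → j ≤ 1 + 2 * r → 2 ∣ j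
  low-even′ j (here refl) j≤ = contradiction j≤ (ℕₚ.<⇒≱ 2r+1<x)
  low-even′ j (there j∈)  j≤ = low-even j j∈ j≤
  single′ : ∀ j → 2 * r < j → mult j (x ∷ xs) ≤ 1
  single′ j 2r<j with j ℕₚ.≟ x
  ... | yes refl = ℕₚ.≤-reflexive (trans (mult-∷-≡ x xs) (cong suc (∉⇒mult≡0 λ x∈ →
          ℕₚ.<⇒≱ (ℕₚ.n<1+n x) (ℕₚ.≤-trans (ℕₚ.n≤1+n (suc x)) (All.lookup gap x∈)))))
  ... | no  j≢x  = subst (_≤ 1) (sym (mult-∷-≢ xs j≢x)) (single j 2r<j)
  apart′ : ∀ j → ¬ (j ∈ x ∷ xs × suc j ∈ x ∷ xs)
  apart′ j (here refl , here 1+x≡x) = ℕₚ.1+n≢n 1+x≡x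
  apart′ j (here refl , there p)    = ℕₚ.<⇒≱ (ℕₚ.n<1+n x)
    (ℕₚ.≤-trans (ℕₚ.m≤n+m (suc x) 2) (All.lookup gap p))
  apart′ j (there p , here refl)    = ℕₚ.<⇒≱ (ℕₚ.n<1+n (suc j)) (All.lookup gap p)
  apart′ j (there p , there r)      = apart j (p , r)

-- Multiplicity one excludes a second x from the tail and the ban on consecutive parts excludes x -
-- 1; this is the gap of 2.
shape-tail : ∀ {r x xs} → 1 + 2 * r < x → Shape r (x ∷ xs) → All (λ z → 2 + z ≤ x) xs × Shape r xs
shape-tail {r} {x} {xs} 2r+1<x (mkShape (x≥ ∷ dec) (_ ∷ pos) low-even rep single apart) =
  All.tabulate gap , mkShape dec pos
    (λ j j∈ → low-even j (there j∈))
    (λ i i<r → subst (2 ≤_) (mult-∷-≢ xs (ℕₚ.<⇒≢ (low i i<r))) (rep i i<r))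
    (λ j 2r<j → ℕₚ.≤-trans (mult-∷-≤ j x xs) (single j 2r<j))
    (λ j (j∈ , 1+j∈) → apart j (there j∈ , there 1+j∈))
  where
  low : ∀ i → i < r → 2 * suc i < x
  low i i<r = ℕₚ.≤-<-trans (ℕₚ.≤-trans (ℕₚ.*-monoʳ-≤ 2 i<r) (ℕₚ.n≤1+n (2 * r))) 2r+1<x
  x∉ : x ∉ xs
  x∉ x∈ = ℕₚ.<⇒≱ (subst (1 <_) (sym (mult-∷-≡ x xs)) (s≤s (∈⇒0<mult x∈)))
    (single x (ℕₚ.<-trans (ℕₚ.n<1+n (2 * r)) 2r+1<x))
  gap : ∀ {z} → z ∈ xs → 2 + z ≤ x
  gap {z} z∈ = ℕₚ.≤∧≢⇒< (ℕₚ.≤∧≢⇒< (All.lookup x≥ z∈) λ z≡x → x∉ (subst (_∈ xs) z≡x z∈))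
    λ 1+z≡x → apart z (there z∈ , here 1+z≡x)

flat⇒shape : ∀ {r d xs} → Flat r d xs → Shape r xs × All (_≤ 1 + 2 * r + d) xs
flat⇒shape {r} (chain c) = chainShape⇒shape s ,
  All.map (λ y≤ → ℕₚ.≤-trans y≤ (ℕₚ.≤-trans (ℕₚ.n≤1+n (2 * r)) (ℕₚ.m≤m+n _ 0))) (ChainShape.bounded s)
  where s = chain⇒shape c
flat⇒shape {r} {suc d} (keep f) with flat⇒shape f
... | s , bdd = s , All.map (λ y≤ → ℕₚ.≤-trans y≤ (ℕₚ.+-monoʳ-≤ (1 + 2 * r) (ℕₚ.n≤1+n d))) bdd
flat⇒shape {r} (one c) =
  shape-∷ (subst (_< 1 + 2 * r + 1) (ℕₚ.+-identityʳ _) (ℕₚ.+-monoʳ-< (1 + 2 * r) (s≤s z≤n)))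
    (All.map (λ y≤ → ℕₚ.≤-trans (s≤s (s≤s y≤)) (ℕₚ.≤-reflexive (ℕₚ.+-comm 1 (1 + 2 * r)))) (ChainShape.bounded s))
    (chainShape⇒shape s) ,
  ℕₚ.≤-refl ∷ All.map
    (λ y≤ → ℕₚ.≤-trans y≤ (ℕₚ.≤-trans (ℕₚ.n≤1+n (2 * r)) (ℕₚ.m≤m+n _ 1))) (ChainShape.bounded s)
  where s = chain⇒shape c
flat⇒shape {r} {suc (suc d)} (add f) with flat⇒shape f
... | s , bdd =
  shape-∷ (ℕₚ.m<m+n (1 + 2 * r) (s≤s z≤n))
    (All.map (λ y≤ → ℕₚ.≤-trans (s≤s (s≤s y≤)) (ℕₚ.≤-reflexive (eq r d))) bdd) s ,
  ℕₚ.≤-refl ∷ All.map (λ y≤ → ℕₚ.≤-trans y≤ (ℕₚ.+-monoʳ-≤ (1 + 2 * r) (ℕₚ.m≤n+m d 2))) bdd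
  where
  eq : ∀ r d → suc (suc (1 + 2 * r + d)) ≡ 1 + 2 * r + (2 + d)
  eq = ℕ-Solver.solve-∀

-- The case split of `A≤`: the largest allowed part is either absent, and d drops by one, or heads
-- the list, and the gap lowers d by two.
shape⇒flat : ∀ {r} d xs → Shape r xs → All (_≤ 1 + 2 * r + d) xs → Flat r d xs
shape⇒flat {r} zero xs s bdd = chain (shape⇒chain r xs
  (shape⇒chainShape s (All.map (λ y≤ → ℕₚ.≤-trans y≤ (ℕₚ.≤-reflexive (ℕₚ.+-identityʳ (1 + 2 * r)))) bdd)))
shape⇒flat (suc d) [] s _ = keep (shape⇒flat d [] s [])
shape⇒flat {r} (suc d) (x ∷ xs) s (x≤ ∷ bdd) with x ℕₚ.≟ 1 + 2 * r + suc d
... | no x≢ = keep (shape⇒flat d (x ∷ xs) s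
    (x≤′ ∷ All.map (λ y≤x → ℕₚ.≤-trans y≤x x≤′) (AllPairs.head (Shape.decreasing s))))
  where
  x≤′ : x ≤ 1 + 2 * r + d
  x≤′ = ℕₚ.≤-pred (subst (x <_) (ℕₚ.+-suc (1 + 2 * r) d) (ℕₚ.≤∧≢⇒< x≤ x≢))
... | yes refl with d | shape-tail (ℕₚ.m<m+n (1 + 2 * r) (s≤s z≤n)) s
-- The head is 2r + 2 and d cannot drop by two; the gap leaves only parts at most 2r, a bare chain.
...   | zero   | gap , s′ = one (shape⇒chain r xs (shape⇒chainShape s′
    (All.map (λ 2+z≤ → ℕₚ.≤-trans (ℕₚ.n≤1+n _)
      (ℕₚ.≤-pred (ℕₚ.≤-trans 2+z≤ (ℕₚ.≤-reflexive (ℕₚ.+-comm (1 + 2 * r) 1))))) gap)))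
...   | suc d′ | gap , s′ = add (shape⇒flat d′ xs s′
    (All.map (λ y+2≤ → ℕₚ.≤-pred (ℕₚ.≤-pred (ℕₚ.≤-trans y+2≤ (ℕₚ.≤-reflexive (eq r d′))))) gap))
  where
  eq : ∀ r d → 1 + 2 * r + (2 + d) ≡ suc (suc (1 + 2 * r + d))
  eq = ℕ-Solver.solve-∀

repeatedParts : List ℕ → List ℕ
repeatedParts xs = filter (λ j → 2 ℕₚ.≤? mult j xs) xs

∈-repeated⁺ : ∀ {j xs} → 2 ≤ mult j xs → j ∈ repeatedParts xs
∈-repeated⁺ {j} {xs} 2≤ =
  ∈-filter⁺ (λ j → 2 ℕₚ.≤? mult j xs) (0<mult⇒∈ {xs = xs} (ℕₚ.<-trans (s≤s z≤n) 2≤)) 2≤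

∈-repeated⁻ : ∀ {j xs} → j ∈ repeatedParts xs → 2 ≤ mult j xs
∈-repeated⁻ {xs = xs} j∈ = proj₂ (∈-filter⁻ (λ j → 2 ℕₚ.≤? mult j xs) {xs = xs} j∈)

≤R₁ : ∀ {j} xs → 2 ≤ mult j xs → j ≤ R₁ xs
≤R₁ xs 2≤ = v≤max⁺ 0 (repeatedParts xs) (inj₂ (lose (∈-repeated⁺ {xs = xs} 2≤) ℕₚ.≤-refl))

shape⇒R₁ : ∀ {r xs} → Shape r xs → R₁ xs ≡ 2 * r
shape⇒R₁ {r} {xs} s = ℕₚ.≤-antisym
  (max≤v⁺ z≤n (All.tabulate λ {j} j∈ → ℕₚ.≮⇒≥ λ 2r<j →
    ℕₚ.<⇒≱ (∈-repeated⁻ {xs = xs} j∈) (Shape.high-single s j 2r<j)))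
  (2r≤ r (Shape.low-repeated s))
  where
  2r≤ : ∀ r → (∀ i → i < r → 2 ≤ mult (2 * suc i) xs) → 2 * r ≤ R₁ xs
  2r≤ zero    _   = z≤n
  2r≤ (suc r) rep = ≤R₁ xs (rep r (ℕₚ.n<1+n r))

shape⇒admissible : ∀ {r xs} → Shape r xs → Admissible xs
shape⇒admissible {r} {xs} s = mkAdmissible
  odd-mult
  (λ j odd j<R → absent j odd (ℕₚ.≤-pred (subst (j <_) R+2≡ j<R)))
  (λ { j (divides (suc i) refl) _ j<R → subst (λ j → 2 ≤ mult j xs) (ℕₚ.*-comm 2 (suc i))
         (Shape.low-repeated s i (ℕₚ.<-trans (ℕₚ.n<1+n i)
           (ℕₚ.*-cancelʳ-< 2 (suc i) r (subst (suc i * 2 <_) (trans (shape⇒R₁ s) (ℕₚ.*-comm 2 r)) j<R)))) })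
  (Shape.no-consecutive s)
  where
  R+2≡ : R₁ xs + 2 ≡ suc (1 + 2 * r)
  R+2≡ = trans (cong (_+ 2) (shape⇒R₁ s)) (ℕₚ.+-comm (2 * r) 2)
  absent : ∀ j → 2 ∤ j → j ≤ 1 + 2 * r → mult j xs ≡ 0
  absent j odd j≤ = ∉⇒mult≡0 λ j∈ → odd (Shape.low-even s j j∈ j≤)
  odd-mult : ∀ j → 2 ∤ j → mult j xs ≤ 1
  odd-mult j odd with 2 * r ℕₚ.<? j
  ... | yes 2r<j = Shape.high-single s j 2r<j
  ... | no  2r≮j = ℕₚ.≤-trans
    (ℕₚ.≤-reflexive (absent j odd (ℕₚ.≤-trans (ℕₚ.≮⇒≥ 2r≮j) (ℕₚ.n≤1+n _)))) z≤n

-- `R₁` is either the default 0 or itself a repeated part, and odd parts do not repeat. The last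
-- component supplies the repetition of `R₁` itself, since `even-repeated` speaks only of parts
-- strictly below it.
R₁-even : ∀ {xs} → Admissible xs → ∃ λ r → R₁ xs ≡ 2 * r × (0 < r → 2 ≤ mult (R₁ xs) xs)
R₁-even {xs} a with argmax-sel id 0 (repeatedParts xs)
... | inj₁ R₁≡0 = 0 , R₁≡0 , λ ()
... | inj₂ R₁∈ with 2 ∣? R₁ xs
...   | yes (divides r R₁≡) = r , trans R₁≡ (ℕₚ.*-comm r 2) , λ _ → ∈-repeated⁻ {xs = xs} R₁∈
...   | no  odd = contradiction (∈-repeated⁻ {xs = xs} R₁∈) (ℕₚ.<⇒≱ (s≤s (Admissible.odd-mult a (R₁ xs) odd)))

admissible⇒shape : ∀ {xs} → AllPairs _≥_ xs → All (0 <_) xs → Admissible xs → ∃ λ r → Shape r xs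
admissible⇒shape {xs} dec pos a with R₁-even a
... | r , R₁≡ , top = r , mkShape dec pos low-even low-repeated high-single (Admissible.no-consecutive a)
  where
  low-even : ∀ j → j ∈ xs → j ≤ 1 + 2 * r → 2 ∣ j
  low-even j j∈ j≤ with 2 ∣? j
  ... | yes 2∣j = 2∣j
  ... | no  odd = contradiction
    (subst (0 <_) (Admissible.odd-absent a j odd
      (subst (j <_) (trans (ℕₚ.+-comm 2 (2 * r)) (cong (_+ 2) (sym R₁≡))) (s≤s j≤))) (∈⇒0<mult j∈))
    ℕₚ.n≮0
  low-repeated : ∀ i → i < r → 2 ≤ mult (2 * suc i) xs
  low-repeated i i<r with suc i ℕₚ.≟ r
  ... | yes 1+i≡r = subst (λ j → 2 ≤ mult j xs) (trans R₁≡ (cong (2 *_) (sym 1+i≡r)))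
    (top (ℕₚ.≤-<-trans z≤n i<r))
  ... | no  1+i≢r = Admissible.even-repeated a (2 * suc i) (m∣m*n (suc i)) (0<2[1+r] i)
    (subst (2 * suc i <_) (sym R₁≡) (ℕₚ.*-monoʳ-< 2 (ℕₚ.≤∧≢⇒< i<r 1+i≢r)))
  high-single : ∀ j → 2 * r < j → mult j xs ≤ 1
  high-single j 2r<j = ℕₚ.≮⇒≥ λ 2≤ → ℕₚ.<⇒≱ (subst (_< j) (sym R₁≡) 2r<j) (≤R₁ xs 2≤)

-- Enumeration by size

Family : Set
Family = ℕ → List (List ℕ)

delay : ℕ → Family → Family
delay zero    L k       = L k
delay (suc a) L zero    = []
delay (suc a) L (suc k) = delay a L k

cons : ℕ → Family → Family
cons a L = delay a (λ k → map (a ∷_) (L k))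

infixr 5 _∪_
_∪_ : Family → Family → Family
(L ∪ M) k = L k ++ M k

nil none : Family
nil zero    = [] ∷ []
nil (suc _) = []
none _ = []

∈-delay⁺ : ∀ a L {k xs} → xs ∈ L k → xs ∈ delay a L (a + k)
∈-delay⁺ zero    L xs∈ = xs∈
∈-delay⁺ (suc a) L xs∈ = ∈-delay⁺ a L xs∈

∈-delay⁻ : ∀ a L k {xs} → xs ∈ delay a L k → ∃ λ j → a + j ≡ k × xs ∈ L j
∈-delay⁻ zero    L k       xs∈ = k , refl , xs∈
∈-delay⁻ (suc a) L (suc k) xs∈ with ∈-delay⁻ a L k xs∈
... | j , refl , xs∈′ = j , refl , xs∈′

delay-! : ∀ a L → (∀ k → Unique (L k)) → ∀ k → Unique (delay a L k)
delay-! zero    L ! k       = ! k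
delay-! (suc a) L ! zero    = []
delay-! (suc a) L ! (suc k) = delay-! a L ! k

-- Only completeness is limited to size n: a recursion with bounded fuel lists correct partitions
-- without repetition but misses some large ones.
record EnumeratesUpTo (n : ℕ) (L : Family) (Q : List ℕ → Set) : Set where
  constructor mkEnumerates
  field
    unique   : ∀ k → Unique (L k)
    sound    : ∀ {k xs} → xs ∈ L k → Q xs × sumᴸ xs ≡ k
    complete : ∀ {xs} → Q xs → sumᴸ xs ≤ n → xs ∈ L (sumᴸ xs)

data Cons (a : ℕ) (Q : List ℕ → Set) : List ℕ → Set where
  mkCons : ∀ {xs} → Q xs → Cons a Q (a ∷ xs)

nil-enumerates : ∀ {n} → EnumeratesUpTo n nil (_≡ [])
nil-enumerates = mkEnumerates unique sound λ { refl _ → here refl }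
  where
  unique : ∀ k → Unique (nil k)
  unique zero    = [] ∷ []
  unique (suc k) = []
  sound : ∀ {k xs} → xs ∈ nil k → xs ≡ [] × sumᴸ xs ≡ k
  sound {zero} (here refl) = refl , refl

cons-enumerates : ∀ {n L Q} a → EnumeratesUpTo n L Q → EnumeratesUpTo (a + n) (cons a L) (Cons a Q)
cons-enumerates {n} {L} {Q} a (mkEnumerates unique sound complete) = mkEnumerates
  (delay-! a _ (λ k → Uniqueₚ.map⁺ ∷-injectiveʳ (unique k)))
  sound′
  λ { (mkCons q) sum≤ → ∈-delay⁺ a _ (∈-map⁺ (a ∷_) (complete q (ℕₚ.+-cancelˡ-≤ a _ _ sum≤))) }
  where
  sound′ : ∀ {k xs} → xs ∈ cons a L k → Cons a Q xs × sumᴸ xs ≡ k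
  sound′ {k} xs∈ with ∈-delay⁻ a _ k xs∈
  ... | j , refl , xs∈′ with ∈-map⁻ (a ∷_) xs∈′
  ...   | ys , ys∈ , refl with sound ys∈
  ...     | q , refl = mkCons q , refl

∪-enumerates : ∀ {n L M Q Q′ R} → EnumeratesUpTo n L Q → EnumeratesUpTo n M Q′ →
  (∀ {xs} → Q xs → ¬ Q′ xs) →
  (∀ {xs} → Q xs → R xs) → (∀ {xs} → Q′ xs → R xs) → (∀ {xs} → R xs → Q xs ⊎ Q′ xs) →
  EnumeratesUpTo n (L ∪ M) R
∪-enumerates {L = L} {M} {R = R} l m disjoint to to′ from = mkEnumerates
  (λ k → Uniqueₚ.++⁺ (l.unique k) (m.unique k)
    (λ (xs∈ , xs∈′) → disjoint (proj₁ (l.sound xs∈)) (proj₁ (m.sound xs∈′))))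
  sound
  (λ {xs} r sum≤ → [ (λ q → ∈-++⁺ˡ (l.complete q sum≤))
                   , (λ q → ∈-++⁺ʳ (L (sumᴸ xs)) (m.complete q sum≤)) ]′ (from r))
  where
  module l = EnumeratesUpTo l
  module m = EnumeratesUpTo m
  sound : ∀ {k xs} → xs ∈ (L ∪ M) k → R xs × sumᴸ xs ≡ k
  sound {k} xs∈ with ∈-++⁻ (L k) xs∈
  ... | inj₁ xs∈L = to (proj₁ (l.sound xs∈L)) , proj₂ (l.sound xs∈L)
  ... | inj₂ xs∈M = to′ (proj₁ (m.sound xs∈M)) , proj₂ (m.sound xs∈M)

enumerates-map : ∀ {n n′ L Q R} → EnumeratesUpTo n L Q → n′ ≤ n →
  (∀ {xs} → Q xs → R xs) → (∀ {xs} → R xs → Q xs) → EnumeratesUpTo n′ L R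
enumerates-map (mkEnumerates unique sound complete) n′≤n to from = mkEnumerates unique
  (λ xs∈ → to (proj₁ (sound xs∈)) , proj₂ (sound xs∈))
  (λ r sum≤ → complete (from r) (ℕₚ.≤-trans sum≤ n′≤n))

-- The first argument bounds the recursion that repeats the largest part.
chains : ℕ → ℕ → Family
chains f       zero    = nil
chains zero    (suc r) = none
chains (suc f) (suc r) =
  cons (2 * suc r) (cons (2 * suc r) (chains (suc f) r)) ∪ cons (2 * suc r) (chains f (suc r))

flats : ℕ → ℕ → ℕ → Family
flats f r zero          = chains f r
flats f r (suc zero)    = chains f r ∪ cons (1 + 2 * r + 1) (chains f r)
flats f r (suc (suc d)) = flats f r (suc d) ∪ cons (1 + 2 * r + (2 + d)) (flats f r d)

chain-head : ∀ {r xs} → Chain (suc r) xs → ∃ λ ys → xs ≡ 2 * suc r ∷ ys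
chain-head (two  {xs = xs} _) = _ , refl
chain-head (more {xs = xs} _) = _ , refl

chain-small : ∀ {r a xs} → 2 * r < a → ¬ Chain r (a ∷ xs)
chain-small 2r<a c with ChainShape.bounded (chain⇒shape c)
... | a≤ ∷ _ = ℕₚ.<⇒≱ 2r<a a≤

-- Fuel f reaches size f because `more` spends one unit of fuel and adds a positive part.
chains-enumerate : ∀ f r → EnumeratesUpTo f (chains f r) (Chain r)
chains-enumerate f       zero    = enumerates-map nil-enumerates (ℕₚ.≤-refl {f})
  (λ { refl → [] }) (λ { [] → refl })
chains-enumerate zero    (suc r) = mkEnumerates (λ _ → []) (λ ())
  (λ c sum≤0 → contradiction sum≤0 (ℕₚ.<⇒≱ (positive c)))
  where
  positive : ∀ {xs} → Chain (suc r) xs → 0 < sumᴸ xs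
  positive (two  _) = s≤s z≤n
  positive (more _) = s≤s z≤n
chains-enumerate (suc f) (suc r) = ∪-enumerates
  (enumerates-map (cons-enumerates a (cons-enumerates a (chains-enumerate (suc f) r)))
    (ℕₚ.≤-trans (ℕₚ.m≤n+m (suc f) a) (ℕₚ.m≤n+m (a + suc f) a)) id id)
  (enumerates-map (cons-enumerates a (chains-enumerate f (suc r))) (s≤s (ℕₚ.m≤n+m f _)) id id)
  disjoint
  (λ { (mkCons (mkCons c)) → two c })
  (λ { (mkCons c) → more c })
  (λ { (two c) → inj₁ (mkCons (mkCons c)) ; (more c) → inj₂ (mkCons c) })
  where
  a = 2 * suc r
  -- In the second family a occurs at least three times, whereas in the first everything after two
  -- copies is at most 2r.
  disjoint : ∀ {xs} → Cons a (Cons a (Chain r)) xs → ¬ Cons a (Chain (suc r)) xs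
  disjoint (mkCons (mkCons c)) (mkCons (two _)) = chain-small (2r<2[1+r] r) c
  disjoint (mkCons (mkCons c)) (mkCons (more c′)) with chain-head c′
  ... | _ , refl = chain-small (2r<2[1+r] r) c

flat-small : ∀ {r d a xs} → 1 + 2 * r + d < a → ¬ Flat r d (a ∷ xs)
flat-small m+d<a f with flat⇒shape f
... | _ , a≤ ∷ _ = ℕₚ.<⇒≱ m+d<a a≤

flats-enumerate : ∀ f r d → EnumeratesUpTo f (flats f r d) (Flat r d)
flats-enumerate f r zero = enumerates-map (chains-enumerate f r) ℕₚ.≤-refl chain λ { (chain c) → c }
flats-enumerate f r (suc zero) = ∪-enumerates
  (chains-enumerate f r)
  (enumerates-map (cons-enumerates (1 + 2 * r + 1) (chains-enumerate f r)) (ℕₚ.m≤n+m f _) id id)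
  (λ { c (mkCons _) → flat-small {r} (ℕₚ.+-monoʳ-< (1 + 2 * r) (s≤s z≤n)) (chain c) })
  (keep ∘ chain)
  (λ { (mkCons c) → one c })
  (λ { (keep (chain c)) → inj₁ c ; (one c) → inj₂ (mkCons c) })
flats-enumerate f r (suc (suc d)) = ∪-enumerates
  (flats-enumerate f r (suc d))
  (enumerates-map (cons-enumerates (1 + 2 * r + (2 + d)) (flats-enumerate f r d)) (ℕₚ.m≤n+m f _) id id)
  (λ { g (mkCons _) → flat-small {r} (ℕₚ.+-monoʳ-< (1 + 2 * r) ℕₚ.≤-refl) g })
  keep
  (λ { (mkCons g) → add g })
  (λ { (keep g) → inj₁ g ; (add g) → inj₂ (mkCons g) })

-- Generating functions

gf : Family → PowerSeries
gf L k = + length (L k)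

gf-∪ : ∀ L M → gf (L ∪ M) ≋ gf L +ₛ gf M
gf-∪ L M = coefficientwise λ k →
  trans (cong +_ (length-++ (L k))) (ℤₚ.pos-+ (length (L k)) (length (M k)))

q*ₛ-suc : ∀ f k → (q *ₛ f) (suc k) ≡ f k
q*ₛ-suc f k = trans (ℤₚ.+-identityˡ ((1ₛ *ₛ f) k)) (*ₛ-identityˡ f k)

gf-delay : ∀ a L → gf (delay a L) ≋ q ^ₛ a *ₛ gf L
gf-delay zero    L = ≋-sym (*-identityˡ (gf L))
gf-delay (suc a) L = coefficientwise λ where
  zero    → sym (*-order (q ^ₛ suc a) (gf L) (suc a) (q^-order (suc a)) 0 (s≤s z≤n))
  (suc k) → trans (at (gf-delay a L) k) (sym (trans
    (at (*-assoc q (q ^ₛ a) (gf L)) (suc k)) (q*ₛ-suc (q ^ₛ a *ₛ gf L) k)))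

gf-cons : ∀ a L → gf (cons a L) ≋ q ^ₛ a *ₛ gf L
gf-cons a L = ≋-trans (gf-delay a (λ k → map (a ∷_) (L k)))
  (*-congˡ (q ^ₛ a) (coefficientwise λ k → cong +_ (length-map (a ∷_) (L k))))

gf-nil : gf nil ≋ 1ₛ
gf-nil = coefficientwise λ { zero → refl ; (suc k) → refl }

-- The counterpart for series of the fuel argument: a positive power of q restores the degree of
-- precision lost with one unit of fuel.
q^suc-gain : ∀ a {f g} k → f ≈[ k ] g → q ^ₛ suc a *ₛ f ≈[ suc k ] q ^ₛ suc a *ₛ g
q^suc-gain a {f} {g} k f≈g zero    _        = trans
  (*-order (q ^ₛ suc a) f (suc a) (q^-order (suc a)) 0 (s≤s z≤n))
  (sym (*-order (q ^ₛ suc a) g (suc a) (q^-order (suc a)) 0 (s≤s z≤n)))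
q^suc-gain a {f} {g} k f≈g (suc j) (s≤s j≤k) = trans (drop f)
  (trans (*ₛ-congˡ≤ (q ^ₛ a) k f≈g j j≤k) (sym (drop g)))
  where
  drop : ∀ f → (q ^ₛ suc a *ₛ f) (suc j) ≡ (q ^ₛ a *ₛ f) j
  drop f = trans (at (*-assoc q (q ^ₛ a) f) (suc j)) (q*ₛ-suc (q ^ₛ a *ₛ f) j)

-- The exponent is the size of the smallest chain, 2(2 + 4 + ⋯ + 2r).
chainWeight : ℕ → PowerSeries
chainWeight r = q ^ₛ (2 * r * (r + 1))

chainWeight-suc : ∀ r → chainWeight (suc r) ≋ y (suc r) *ₛ (y (suc r) *ₛ chainWeight r)
chainWeight-suc r = ≋-trans (q^-cong (exponent r))
  (≋-trans (^ₛ-+ q (2 * suc r) (2 * suc r + 2 * r * (r + 1)))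
    (*-congˡ (y (suc r)) (^ₛ-+ q (2 * suc r) (2 * r * (r + 1)))))
  where
  exponent : ∀ r → 2 * suc r * (suc r + 1) ≡ 2 * suc r + (2 * suc r + 2 * r * (r + 1))
  exponent = ℕ-Solver.solve-∀

gf-chains-suc : ∀ f r → gf (chains (suc f) (suc r)) ≋
  y (suc r) *ₛ (y (suc r) *ₛ gf (chains (suc f) r)) +ₛ y (suc r) *ₛ gf (chains f (suc r))
gf-chains-suc f r = ≋-trans
  (gf-∪ (cons a (cons a (chains (suc f) r))) (cons a (chains f (suc r))))
  (+-cong
    (≋-trans (gf-cons a (cons a (chains (suc f) r))) (*-congˡ (q ^ₛ a) (gf-cons a (chains (suc f) r))))
    (gf-cons a (chains f (suc r))))
  where a = 2 * suc r

-- With w = q^(2r+2), unlimited fuel would give (1 - w) G_{r+1} = w² G_r, and (1 - w) is also the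
-- new factor of `E (suc r)`. With fuel the two occurrences of G_{r+1} differ, so each is handled by
-- its own induction hypothesis.
gf-chains*E : ∀ f r → gf (chains f r) *ₛ E r ≈[ f ] chainWeight r
gf-chains*E f       zero    j _ = at (≋-trans (*-identityʳ (gf nil)) gf-nil) j
gf-chains*E zero    (suc r) zero z≤n = sym (q^-order (2 * suc r * (suc r + 1)) 0 (s≤s z≤n))
gf-chains*E (suc f) (suc r) j j≤ = begin
  (gf (chains (suc f) (suc r)) *ₛ e′) j
    ≡⟨ at (*-congʳ e′ (gf-chains-suc f r)) j ⟩
  ((w *ₛ (w *ₛ g) +ₛ w *ₛ g′) *ₛ e′) j
    ≡⟨ at (expand w g g′ e′) j ⟩
  (w *ₛ (w *ₛ (g *ₛ e′)) +ₛ w *ₛ (g′ *ₛ e′)) j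
    -- `r + 1 * suc r` is the predecessor of `2 * suc r` by computation.
    ≡⟨ cong (ℤ._+_ ((w *ₛ (w *ₛ (g *ₛ e′))) j)) (q^suc-gain (r + 1 * suc r) {g′ *ₛ e′} {chainWeight (suc r)} f (gf-chains*E f (suc r)) j j≤) ⟩
  (w *ₛ (w *ₛ (g *ₛ e′)) +ₛ w *ₛ chainWeight (suc r)) j
    ≡⟨ at (+-congˡ (w *ₛ (w *ₛ (g *ₛ e′))) (≋-trans (*-congˡ w (chainWeight-suc r))
         (commute w (chainWeight r)))) j ⟩
  (w *ₛ (w *ₛ (g *ₛ e′)) +ₛ w *ₛ (w *ₛ w) *ₛ chainWeight r) j
    -- The weight is expanded back into `g *ₛ e`, so that `e′` and `e *ₛ w` meet and `E-step`
    -- applies.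
    ≡⟨ cong (ℤ._+_ ((w *ₛ (w *ₛ (g *ₛ e′))) j))
         (*ₛ-congˡ≤ (w *ₛ (w *ₛ w)) (suc f) (gf-chains*E (suc f) r) j j≤) ⟨
  (w *ₛ (w *ₛ (g *ₛ e′)) +ₛ w *ₛ (w *ₛ w) *ₛ (g *ₛ e)) j
    ≡⟨ at (collect w g e e′) j ⟩
  (w *ₛ w *ₛ g *ₛ (e′ +ₛ e *ₛ w)) j
    ≡⟨ at (*-congˡ (w *ₛ w *ₛ g) (E-step r)) j ⟩
  (w *ₛ w *ₛ g *ₛ e) j
    ≡⟨ at (*-assoc (w *ₛ w) g e) j ⟩
  (w *ₛ w *ₛ (g *ₛ e)) j
    ≡⟨ *ₛ-congˡ≤ (w *ₛ w) (suc f) (gf-chains*E (suc f) r) j j≤ ⟩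
  (w *ₛ w *ₛ chainWeight r) j
    ≡⟨ at (≋-trans (*-assoc w w (chainWeight r)) (≋-sym (chainWeight-suc r))) j ⟩
  chainWeight (suc r) j ∎
  where
  open ≡-Reasoning
  open SeriesSolver
  w e e′ g g′ : PowerSeries
  w  = y (suc r)
  e  = E r
  e′ = E (suc r)
  g  = gf (chains (suc f) r)
  g′ = gf (chains f (suc r))
  expand : ∀ w g g′ e → (w *ₛ (w *ₛ g) +ₛ w *ₛ g′) *ₛ e ≋ w *ₛ (w *ₛ (g *ₛ e)) +ₛ w *ₛ (g′ *ₛ e)
  expand = solve 4 (λ w g g′ e →
    (w :* (w :* g) :+ w :* g′) :* e := w :* (w :* (g :* e)) :+ w :* (g′ :* e)) ≋-refl
  commute : ∀ w h → w *ₛ (w *ₛ (w *ₛ h)) ≋ w *ₛ (w *ₛ w) *ₛ h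
  commute = solve 2 (λ w h → w :* (w :* (w :* h)) := w :* (w :* w) :* h) ≋-refl
  collect : ∀ w g e e′ →
    w *ₛ (w *ₛ (g *ₛ e′)) +ₛ w *ₛ (w *ₛ w) *ₛ (g *ₛ e) ≋ w *ₛ w *ₛ g *ₛ (e′ +ₛ e *ₛ w)
  collect = solve 4 (λ w g e e′ →
    w :* (w :* (g :* e′)) :+ w :* (w :* w) :* (g :* e) := w :* w :* g :* (e′ :+ e :* w)) ≋-refl

gf-chains : ∀ f r → gf (chains f r) ≈[ f ] x r 1
gf-chains f r j j≤ = trans
  (at (≋-trans (≋-sym (*-identityʳ g)) (≋-trans
    (*-congˡ g (≋-trans (≋-sym (E⁻¹-inverse r)) (*-comm (E⁻¹ r) (E r))))
    (≋-sym (*-assoc g (E r) (E⁻¹ r))))) j)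
  (*ₛ-congʳ≤ (E⁻¹ r) f (gf-chains*E f r) j j≤)
  where g = gf (chains f r)

-- Exact in every degree: `flats` follows the recursion of `A≤`, and the fuel enters only through
-- the chain factor.
gf-flats : ∀ f r d → gf (flats f r d) ≋ gf (chains f r) *ₛ A≤ d (1 + 2 * r)
gf-flats f r zero       = ≋-sym (*-identityʳ (gf (chains f r)))
gf-flats f r (suc zero) = ≋-trans
  (gf-∪ (chains f r) (cons (1 + 2 * r + 1) (chains f r)))
  (≋-trans (+-congˡ g (gf-cons (1 + 2 * r + 1) (chains f r)))
    (≋-trans (+-cong (≋-sym (*-identityʳ g)) (≋-trans
        (*-comm (q ^ₛ (1 + 2 * r + 1)) g)
        (*-congˡ g (≋-sym (*-identityʳ (q ^ₛ (1 + 2 * r + 1)))))))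
      (≋-sym (distribˡ g 1ₛ (q ^ₛ (1 + 2 * r + 1) *ₛ 1ₛ)))))
  where g = gf (chains f r)
gf-flats f r (suc (suc d)) = ≋-trans
  (gf-∪ (flats f r (suc d)) (cons (1 + 2 * r + (2 + d)) (flats f r d)))
  (≋-trans
    (+-cong (gf-flats f r (suc d)) (≋-trans (gf-cons (1 + 2 * r + (2 + d)) (flats f r d))
      (*-congˡ (q ^ₛ (1 + 2 * r + (2 + d))) (gf-flats f r d))))
    (collect (gf (chains f r)) (A≤ (suc d) (1 + 2 * r)) (q ^ₛ (1 + 2 * r + (2 + d))) (A≤ d (1 + 2 * r))))
  where
  open SeriesSolver
  collect : ∀ g a w b → g *ₛ a +ₛ w *ₛ (g *ₛ b) ≋ g *ₛ (a +ₛ w *ₛ b)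
  collect = solve 4 (λ g a w b → g :* a :+ w :* (g :* b) := g :* (a :+ w :* b)) ≋-refl

gf-flats-coefficient : ∀ k r → gf (flats k r k) k ≡ (x r 1 *ₛ gapTerm r 1) k
gf-flats-coefficient k r = trans (at (gf-flats k r k) k) (trans
  (*ₛ-congʳ≤ (A≤ k (1 + 2 * r)) k (gf-chains k r) k ℕₚ.≤-refl)
  (*ₛ-congˡ≤ (x r 1) k (λ j j≤k → A≤-limit k (1 + 2 * r) j j≤k) k ℕₚ.≤-refl))

-- Counting admissible partitions

admissibles : ℕ → ℕ → List (List ℕ)
admissibles N k = concatMap (λ r → flats k r k k) (upTo N)

flat⇒R₁ : ∀ {r d xs} → Flat r d xs → R₁ xs ≡ 2 * r
flat⇒R₁ f = shape⇒R₁ (proj₁ (flat⇒shape f))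

-- No list is shared by two values of r, because r can be read off as half of `R₁`.
admissibles-! : ∀ N k → Unique (admissibles N k)
admissibles-! N k = Uniqueₚ.concat⁺
  (Allₚ.map⁺ (All.universal (λ r → EnumeratesUpTo.unique (flats-enumerate k r k) k) (upTo N)))
  (AllPairsₚ.map⁺ (AllPairs.map disjoint (Uniqueₚ.upTo⁺ N)))
  where
  disjoint : ∀ {r s} → r ≢ s → Disjoint (flats k r k k) (flats k s k k)
  disjoint {r} {s} r≢s (xs∈ , xs∈′) = r≢s (ℕₚ.*-cancelˡ-≡ r s 2 (trans
    (sym (flat⇒R₁ (proj₁ (EnumeratesUpTo.sound (flats-enumerate k r k) xs∈))))
    (flat⇒R₁ (proj₁ (EnumeratesUpTo.sound (flats-enumerate k s k) xs∈′)))))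

≤-sum : ∀ {j xs} → j ∈ xs → j ≤ sumᴸ xs
≤-sum {xs = x ∷ xs} (here refl) = ℕₚ.m≤m+n x (sumᴸ xs)
≤-sum {xs = x ∷ xs} (there j∈)  = ℕₚ.≤-trans (≤-sum j∈) (ℕₚ.m≤n+m (sumᴸ xs) x)

shape⇒r≤sum : ∀ {r xs} → Shape r xs → r ≤ sumᴸ xs
shape⇒r≤sum {zero}  s = z≤n
shape⇒r≤sum {suc r} {xs} s = ℕₚ.≤-trans (ℕₚ.m≤n*m (suc r) 2) (≤-sum (0<mult⇒∈ {xs = xs}
  (ℕₚ.<-trans (s≤s z≤n) (Shape.low-repeated s r (ℕₚ.n<1+n r)))))

admissibles-set : ∀ {N k} → k < N → ∀ {xs} →
  xs ∈ admissibles N k ⇔ xs ∈ filter admissible? (partitions k)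
admissibles-set {N} {k} k<N {xs} = mk⇔ to from
  where
  to : xs ∈ admissibles N k → xs ∈ filter admissible? (partitions k)
  to xs∈ with find (∈-concatMap⁻ (λ r → flats k r k k) {upTo N} xs∈)
  ... | r , _ , xs∈r with EnumeratesUpTo.sound (flats-enumerate k r k) xs∈r
  ... | f , sum≡ with proj₁ (flat⇒shape f)
  ... | s = ∈-filter⁺ admissible?
    (Equivalence.from (∈-partitions k xs)
      (mkPartition (Linkedₚ.AllPairs⇒Linked (Shape.decreasing s)) (Shape.positive s) sum≡))
    (shape⇒admissible s)
  from : xs ∈ filter admissible? (partitions k) → xs ∈ admissibles N k
  from xs∈ with ∈-filter⁻ admissible? {xs = partitions k} xs∈
  ... | xs∈p , adm with Equivalence.to (∈-partitions k xs) xs∈p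
  ... | mkPartition dec pos refl
    with admissible⇒shape (Linkedₚ.Linked⇒AllPairs (λ p r → ℕₚ.≤-trans r p) dec) pos adm
  ... | r , s = ∈-concatMap⁺ (λ r → flats k r k k) (lose
    (∈-upTo⁺ (ℕₚ.≤-<-trans (shape⇒r≤sum s) k<N))
    (EnumeratesUpTo.complete (flats-enumerate k r k)
      (shape⇒flat k xs s (All.tabulate λ j∈ → ℕₚ.≤-trans (≤-sum j∈) (ℕₚ.m≤n+m k (1 + 2 * r))))
      ℕₚ.≤-refl))

T≡length : ∀ N k → k < N → length (admissibles N k) ≡ T k
T≡length N k k<N = ↭-length (∼bag⇒↭ (unique∧set⇒bag (admissibles-! N k)
  (Uniqueₚ.filter⁺ admissible? (partitions-! k)) (admissibles-set k<N)))

length-concatMap : ∀ (L : ℕ → List (List ℕ)) (h : ℕ → ℕ) N →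
  + length (concatMap L (applyUpTo h N)) ≡ ∑[ n < N ] (+ length (L (h (toℕ n))))
length-concatMap L h zero    = refl
length-concatMap L h (suc N) = trans (cong +_ (length-++ (L (h 0))))
  (trans (ℤₚ.pos-+ (length (L (h 0))) (length (concatMap L (applyUpTo (h ∘ suc) N))))
    (cong (ℤ._+_ (+ length (L (h 0)))) (length-concatMap L (h ∘ suc) N)))

partialSum-suc : ∀ t N k → partialSum t (suc N) k ≡ t 0 k ℤ.+ partialSum (t ∘ suc) N k
partialSum-suc t zero    k = ℤₚ.+-comm 0ℤ (t 0 k)
partialSum-suc t (suc N) k = trans (cong (ℤ._+ t (suc N) k) (partialSum-suc t N k))
  (ℤₚ.+-assoc (t 0 k) (partialSum (t ∘ suc) N k) (t (suc N) k))

∑≡partialSum : ∀ t N k → ∑[ n < N ] (t (toℕ n) k) ≡ partialSum t N k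
∑≡partialSum t zero    k = refl
∑≡partialSum t (suc N) k =
  trans (cong (ℤ._+_ (t 0 k)) (∑≡partialSum (t ∘ suc) N k)) (sym (partialSum-suc t N k))

theorem11 : (λ n → (q ^ₛ (2 * n * (n + 1)) *ₛ ⟨ q ⨾ q ^ₛ 2 ⟩ n *ₛ ⟨ -ₛ (q ^ₛ (2 * n + 2)) ⨾ q ⟩∞)
    /ₛ (⟨ q ^ₛ 2 ⨾ q ^ₛ 2 ⟩ n))
    SumsTo (λ n → + T n)
-- N > k also guarantees that every r occurring in a partition of k is below N, since r is at most
-- the size.
theorem11 k = suc k , λ N k<N → begin
  ∑[ n < N ] (summand (toℕ n) k)
    ≡⟨ sum-cong-≗ {N} (λ n → at (term-quotient (toℕ n)) k) ⟩
  ∑[ n < N ] ((x (toℕ n) 1 *ₛ productTerm (toℕ n) 1) k)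
    ≡⟨ ∑≡partialSum (λ n → x n 1 *ₛ productTerm n 1) N k ⟩
  partialSum (λ n → x n 1 *ₛ productTerm n 1) N k
    ≡⟨ gap≡product N k k<N ⟨
  partialSum (λ n → x n 1 *ₛ gapTerm n 1) N k
    ≡⟨ ∑≡partialSum (λ n → x n 1 *ₛ gapTerm n 1) N k ⟨
  ∑[ n < N ] ((x (toℕ n) 1 *ₛ gapTerm (toℕ n) 1) k)
    ≡⟨ sum-cong-≗ {N} (λ n → gf-flats-coefficient k (toℕ n)) ⟨
  ∑[ n < N ] (+ length (flats k (toℕ n) k k))
    ≡⟨ length-concatMap (λ r → flats k r k k) id N ⟨
  + length (admissibles N k)
    ≡⟨ cong +_ (T≡length N k k<N) ⟩
  + T k ∎
  where
  open ≡-Reasoning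
  summand : ℕ → PowerSeries
  summand n = (q ^ₛ (2 * n * (n + 1)) *ₛ ⟨ q ⨾ q ^ₛ 2 ⟩ n *ₛ ⟨ -ₛ (q ^ₛ (2 * n + 2)) ⨾ q ⟩∞)
    /ₛ (⟨ q ^ₛ 2 ⨾ q ^ₛ 2 ⟩ n)
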